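{- Let $\gamma \geq 0$ be an integer. The operad $\mathsf{Dendr}_\gamma$ admits the following presentation. It is generated by $\{\prec_b, \succ_b : b \in [\gamma]\}$ and its space of relations is generated by $$\prec_a \circ_1 \succ_{a'} - \succ_{a'} \circ_2 \prec_a, \qquad a, a' \in [\gamma],$$ $$\prec_a \circ_1 \prec_b - \prec_a \circ_2 \succ_b - \prec_a \circ_2 \prec_a, \qquad a < b \in [\gamma],$$ $$\succ_a \circ_1 \succ_a + \succ_a \circ_1 \prec_b - \succ_a \circ_2 \succ_b, \qquad a < b \in [\gamma],$$ $$\prec_b \circ_1 \prec_a - \prec_a \circ_2 \prec_b - \prec_a \circ_2 \succ_a, \qquad a < b \in [\gamma],$$ $$\succ_a \circ_1 \prec_a + \succ_a \circ_1 \succ_b - \succ_b \circ_2 \succ_a, \qquad a < b \in [\gamma],$$ $$\prec_a \circ_1 \prec_a - \prec_a \circ_2 \succ_a - \prec_a \circ_2 \prec_a, \qquad a \in [\gamma],$$ $$\succ_a \circ_1 \succ_a + \succ_a \circ_1 \prec_a - \succ_a \circ_2 \succ_a, \qquad a \in [\gamma].$$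
   Context: The ground field has characteristic zero; operad means nonsymmetric operad; $[n] = \{1, \dots, n\}$; $a \uparrow a' := \max(a, a')$. $\mathbf{Free}(\mathfrak{G})$ is the free operad on a set $\mathfrak{G}$ of binary generators; $(\mathfrak{G}, \mathfrak{R})$ is a presentation of $\mathcal{O}$ if $\mathcal{O} \cong \mathbf{Free}(\mathfrak{G})/\langle \mathfrak{R} \rangle$, with $\langle \mathfrak{R} \rangle$ the operad ideal generated by the subspace $\mathfrak{R}$. Koszul dual: if $\mathcal{O}$ has a presentation $(\mathfrak{G}, \mathfrak{R})$ with $\mathfrak{G}$ in arity $2$ and $\mathfrak{R} \subseteq \mathbf{Free}(\mathfrak{G})(3)$, its Koszul dual is $\mathbf{Free}(\mathfrak{G})/\langle \mathfrak{R}^\perp \rangle$, where $\mathfrak{R}^\perp$ is the annihilator of $\mathfrak{R}$ in $\mathbf{Free}(\mathfrak{G})(3)$ for the bilinear form with $\langle x \circ_i y, x' \circ_{i'} y' \rangle = 1$ if $x = x', y = y', i = i' = 1$; $= -1$ if $x = x', y = y', i = i' = 2$; and $0$ otherwise ($x, x', y, y' \in \mathfrak{G}$). $\mathsf{Dias}_\gamma$ is the operad presented by binary generators $\dashv_a, \vdash_a$, $a \in [\gamma]$, and the space of relations spanned, for all $a, a' \in [\gamma]$, by $\dashv_a \circ_1 \vdash_{a'} - \vdash_{a'} \circ_2 \dashv_a$; $\dashv_a \circ_1 \dashv_{a \uparrow a'} - \dashv_a \circ_2 \vdash_{a'}$; $\vdash_a \circ_1 \dashv_{a'} - \vdash_a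 \circ_2 \vdash_{a \uparrow a'}$; $\dashv_{a \uparrow a'} \circ_1 \dashv_a - \dashv_a \circ_2 \dashv_{a'}$; $\vdash_a \circ_1 \vdash_{a'} - \vdash_{a \uparrow a'} \circ_2 \vdash_a$. $\mathsf{Dendr}_\gamma$ is the Koszul dual of $\mathsf{Dias}_\gamma$ computed from this presentation, where in the dual the generators corresponding to $\dashv_a$ and $\vdash_a$ are denoted by $\leftharpoonup_a$ and $\rightharpoonup_a$ respectively. In $\mathbf{Free}(\{\leftharpoonup_a, \rightharpoonup_a : a \in [\gamma]\})(2)$ set, for $b \in [\gamma]$, $\prec_b := \sum_{a \in [b]} \leftharpoonup_a$ and $\succ_b := \sum_{a \in [b]} \rightharpoonup_a$. These elements form a basis of this space, so that the free operads on $\{\leftharpoonup_a, \rightharpoonup_a\}$ and on $\{\prec_b, \succ_b\}$ are identified. -}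

module Defs where

open import Level using (Level; _⊔_)
import Level
open import Algebra.Apartness.Bundles
  using (HeytingField; module HeytingCommutativeRing)
open import Algebra.Bundles using (CommutativeMonoid; CommutativeRing)
open import Algebra.Module.Bundles using (Module)
open import Algebra.Module.Structures.Biased using (module IsModuleFromLeft)
open import Algebra.Module.Morphism.Structures using (IsModuleIsomorphism)
import Algebra.Construct.NaturalChoice.Max as Max
import Algebra.Definitions.RawMonoid as RawMonoidDefs
import Algebra.Module.Construct.TensorUnit as TensorUnit
import Algebra.Properties.AbelianGroup as AbelianGroupProperties
import Algebra.Properties.CommutativeSemigroup as CommutativeSemigroupProperties
open import Data.Bool.Base using (if_then_else_; _∧_)
open import Data.Fin.Base as Fin using (Fin; toℕ; inject≤)
import Data.Fin.Properties as Fin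
open import Data.Nat.Base as ℕ using (ℕ; zero; suc; s≤s)
import Data.Nat.Properties as ℕ
open import Data.Product.Base using (_,_)
open import Function.Base using (flip; _∘_)
open import Relation.Binary.Definitions using (DecidableEquality)
open import Relation.Binary.PropositionalEquality.Core as ≡ using (_≡_)
import Relation.Binary.PropositionalEquality.Properties as ≡
open import Relation.Nullary using (¬_; yes; no; does; contradiction; recompute; map′)
open import Relation.Unary using (Pred; _∈_)

private
  variable
    c ℓ ℓ₁ ℓ₂ g m ℓm p ℓp s : Level

------------------------------------------------------------------------

-- Classically, Heyting fields are exactly fields (with x # y meaning x ≉ y).
fieldRing : HeytingField c ℓ₁ ℓ₂ → CommutativeRing c ℓ₁
fieldRing K = HeytingCommutativeRing.commutativeRing (HeytingField.heytingCommutativeRing K)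

CharacteristicZero : HeytingField c ℓ₁ ℓ₂ → Set ℓ₁
CharacteristicZero K = ∀ n → ¬ (suc n × 1# ≈ 0#)
  where
  open CommutativeRing (fieldRing K)
  open RawMonoidDefs +-rawMonoid using (_×_)

------------------------------------------------------------------------

data Tree (G : Set g) : Set g where
  leaf : Tree G
  node : G → Tree G → Tree G → Tree G

module _ {G : Set g} where

  leaves : Tree G → ℕ
  leaves leaf         = 1
  leaves (node _ l r) = leaves l ℕ.+ leaves r

  -- Leaves are numbered from 0, left to right; the index i is only
  -- meaningful when i < leaves t.
  graft : Tree G → ℕ → Tree G → Tree G
  graft leaf         _ s = s
  graft (node x l r) i s with i ℕ.<? leaves l
  ... | yes _ = node x (graft l i s) r
  ... | no  _ = node x l (graft r (i ℕ.∸ leaves l) s)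

  graft-left : ∀ x l r s {i} → i ℕ.< leaves l →
               graft (node x l r) i s ≡ node x (graft l i s) r
  graft-left _ l _ _ {i} i<l with i ℕ.<? leaves l
  ... | yes _  = ≡.refl
  ... | no i≮l = contradiction i<l i≮l

  graft-right : ∀ x l r s i →
                graft (node x l r) (leaves l ℕ.+ i) s ≡ node x l (graft r i s)
  graft-right x l r s i with leaves l ℕ.+ i ℕ.<? leaves l
  ... | yes l+i<l = contradiction l+i<l (ℕ.m+n≮m (leaves l) i)
  ... | no  _     = ≡.cong (λ j → node x l (graft r j s)) (ℕ.m+n∸m≡n (leaves l) i)

  data Side (a b i : ℕ) : Set where
    left  : i ℕ.< a → Side a b i
    right : ∀ j → j ℕ.< b → a ℕ.+ j ≡ i → Side a b i

  side : ∀ a {b i} → i ℕ.< a ℕ.+ b → Side a b i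
  side a {b} {i} i<a+b with i ℕ.<? a
  ... | yes i<a = left i<a
  ... | no  i≮a = right (i ℕ.∸ a)
    (ℕ.+-cancelˡ-< a _ _ (≡.subst (ℕ._< a ℕ.+ b) (≡.sym a+[i∸a]≡i) i<a+b))
    a+[i∸a]≡i
    where
    a+[i∸a]≡i : a ℕ.+ (i ℕ.∸ a) ≡ i
    a+[i∸a]≡i = ℕ.m+[n∸m]≡n (ℕ.≮⇒≥ i≮a)

  leaves-graft : ∀ t {i} s → i ℕ.< leaves t →
                 suc (leaves (graft t i s)) ≡ leaves t ℕ.+ leaves s
  leaves-graft leaf         s _   = ≡.refl
  leaves-graft (node x l r) s i<t with side (leaves l) i<t
  ... | left i<l = begin
    suc (leaves (graft (node x l r) _ s))          ≡⟨ ≡.cong (suc ∘ leaves) (graft-left x l r s i<l) ⟩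
    suc (leaves (graft l _ s)) ℕ.+ leaves r        ≡⟨ ≡.cong (ℕ._+ leaves r) (leaves-graft l s i<l) ⟩
    leaves l ℕ.+ leaves s ℕ.+ leaves r               ≡⟨ xy∙z≈xz∙y (leaves l) (leaves s) (leaves r) ⟩
    leaves l ℕ.+ leaves r ℕ.+ leaves s               ∎
    where open ≡.≡-Reasoning
          open CommutativeSemigroupProperties ℕ.+-commutativeSemigroup
  ... | right j j<r ≡.refl = begin
    suc (leaves (graft (node x l r) _ s))          ≡⟨ ≡.cong (suc ∘ leaves) (graft-right x l r s j) ⟩
    suc (leaves l ℕ.+ leaves (graft r j s))        ≡⟨ ℕ.+-suc (leaves l) _ ⟨
    leaves l ℕ.+ suc (leaves (graft r j s))        ≡⟨ ≡.cong (leaves l ℕ.+_) (leaves-graft r s j<r) ⟩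
    leaves l ℕ.+ (leaves r ℕ.+ leaves s)             ≡⟨ ℕ.+-assoc (leaves l) _ _ ⟨
    leaves l ℕ.+ leaves r ℕ.+ leaves s               ∎
    where open ≡.≡-Reasoning

  graft-leaf : ∀ t {i} → i ℕ.< leaves t → graft t i leaf ≡ t
  graft-leaf leaf         _   = ≡.refl
  graft-leaf (node x l r) i<t with side (leaves l) i<t
  ... | left i<l           = ≡.trans (graft-left x l r leaf i<l) (≡.cong (λ l′ → node x l′ r) (graft-leaf l i<l))
  ... | right j j<r ≡.refl = ≡.trans (graft-right x l r leaf j) (≡.cong (node x l) (graft-leaf r j<r))

  graft-sequential : ∀ t s u {i j} → i ℕ.< leaves t → j ℕ.< leaves s →
                     graft (graft t i s) (i ℕ.+ j) u ≡ graft t i (graft s j u)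
  graft-sequential leaf         s u {zero}    _         _   = ≡.refl
  graft-sequential leaf         s u {suc _} (s≤s ()) _
  graft-sequential (node x l r) s u {i} {j}   i<t       j<s with side (leaves l) i<t
  ... | left i<l = begin
    graft (graft (node x l r) i s) (i ℕ.+ j) u       ≡⟨ ≡.cong (λ t → graft t (i ℕ.+ j) u) (graft-left x l r s i<l) ⟩
    graft (node x (graft l i s) r) (i ℕ.+ j) u       ≡⟨ graft-left x (graft l i s) r u i+j<l′ ⟩
    node x (graft (graft l i s) (i ℕ.+ j) u) r       ≡⟨ ≡.cong (λ l′ → node x l′ r) (graft-sequential l s u i<l j<s) ⟩
    node x (graft l i (graft s j u)) r               ≡⟨ graft-left x l r (graft s j u) i<l ⟨
    graft (node x l r) i (graft s j u)               ∎
    where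
    open ≡.≡-Reasoning
    i+j<l′ : i ℕ.+ j ℕ.< leaves (graft l i s)
    i+j<l′ = ℕ.s≤s⁻¹ (≡.subst (suc (suc (i ℕ.+ j)) ℕ.≤_) (≡.sym (leaves-graft l s i<l))
      (≡.subst (ℕ._≤ leaves l ℕ.+ leaves s) (≡.cong suc (ℕ.+-suc i j)) (ℕ.+-mono-≤ i<l j<s)))
  ... | right i′ i′<r ≡.refl = begin
    graft (graft (node x l r) (leaves l ℕ.+ i′) s) (leaves l ℕ.+ i′ ℕ.+ j) u  ≡⟨ ≡.cong₂ (λ t k → graft t k u) (graft-right x l r s i′) (ℕ.+-assoc (leaves l) i′ j) ⟩
    graft (node x l (graft r i′ s)) (leaves l ℕ.+ (i′ ℕ.+ j)) u               ≡⟨ graft-right x l (graft r i′ s) u (i′ ℕ.+ j) ⟩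
    node x l (graft (graft r i′ s) (i′ ℕ.+ j) u)                              ≡⟨ ≡.cong (node x l) (graft-sequential r s u i′<r j<s) ⟩
    node x l (graft r i′ (graft s j u))                                       ≡⟨ graft-right x l r (graft s j u) i′ ⟨
    graft (node x l r) (leaves l ℕ.+ i′) (graft s j u)                        ∎
    where open ≡.≡-Reasoning

  graft-parallel : ∀ t s u {i j h} → i ℕ.< j → j ℕ.< leaves t →
                   suc h ≡ j ℕ.+ leaves s →
                   graft (graft t i s) h u ≡ graft (graft t j u) i s
  graft-parallel leaf         s u {i} {zero}    () _ _
  graft-parallel leaf         s u {i} {suc _} _ (s≤s ()) _
  graft-parallel (node x l r) s u {i} {j} {h} i<j j<t eq with side (leaves l) j<t
  ... | left j<l = begin
    graft (graft (node x l r) i s) h u               ≡⟨ ≡.cong (λ t → graft t h u) (graft-left x l r s i<l) ⟩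
    graft (node x (graft l i s) r) h u               ≡⟨ graft-left x (graft l i s) r u h<l′ ⟩
    node x (graft (graft l i s) h u) r               ≡⟨ ≡.cong (λ l′ → node x l′ r) (graft-parallel l s u i<j j<l eq) ⟩
    node x (graft (graft l j u) i s) r               ≡⟨ graft-left x (graft l j u) r s i<l″ ⟨
    graft (node x (graft l j u) r) i s               ≡⟨ ≡.cong (λ t → graft t i s) (graft-left x l r u j<l) ⟨
    graft (graft (node x l r) j u) i s               ∎
    where
    open ≡.≡-Reasoning
    i<l : i ℕ.< leaves l
    i<l = ℕ.<-trans i<j j<l
    h<l′ : h ℕ.< leaves (graft l i s)
    h<l′ = ℕ.s≤s⁻¹ (≡.subst₂ ℕ._≤_ (≡.cong suc (≡.sym eq)) (≡.sym (leaves-graft l s i<l)) (ℕ.+-monoˡ-≤ (leaves s) j<l))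
    i<l″ : i ℕ.< leaves (graft l j u)
    i<l″ = ℕ.≤-trans i<j (ℕ.s≤s⁻¹ (≡.subst (suc j ℕ.≤_) (≡.sym (leaves-graft l u j<l)) (ℕ.≤-trans j<l (ℕ.m≤m+n _ _))))
  ... | right j′ j′<r ≡.refl with side (leaves l) (ℕ.<-trans i<j j<t)
  ...   | left i<l = begin
    graft (graft (node x l r) i s) h u                            ≡⟨ ≡.cong (λ t → graft t h u) (graft-left x l r s i<l) ⟩
    graft (node x (graft l i s) r) h u                            ≡⟨ ≡.cong (λ k → graft (node x (graft l i s) r) k u) h≡ ⟩
    graft (node x (graft l i s) r) (leaves (graft l i s) ℕ.+ j′) u ≡⟨ graft-right x (graft l i s) r u j′ ⟩
    node x (graft l i s) (graft r j′ u)                           ≡⟨ graft-left x l (graft r j′ u) s i<l ⟨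
    graft (node x l (graft r j′ u)) i s                           ≡⟨ ≡.cong (λ t → graft t i s) (graft-right x l r u j′) ⟨
    graft (graft (node x l r) (leaves l ℕ.+ j′) u) i s            ∎
    where
    open ≡.≡-Reasoning
    open CommutativeSemigroupProperties ℕ.+-commutativeSemigroup
    h≡ : h ≡ leaves (graft l i s) ℕ.+ j′
    h≡ = ℕ.suc-injective (≡.trans eq (≡.trans (xy∙z≈xz∙y (leaves l) j′ (leaves s))
      (≡.cong (ℕ._+ j′) (≡.sym (leaves-graft l s i<l)))))
  ...   | right i′ i′<r ≡.refl = go i′<j′ eq
    where
    open ≡.≡-Reasoning
    i′<j′ : i′ ℕ.< j′
    i′<j′ = ℕ.+-cancelˡ-< (leaves l) i′ j′ i<j
    go : ∀ {h} → i′ ℕ.< j′ → suc h ≡ leaves l ℕ.+ j′ ℕ.+ leaves s →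
         graft (graft (node x l r) (leaves l ℕ.+ i′) s) h u ≡
         graft (graft (node x l r) (leaves l ℕ.+ j′) u) (leaves l ℕ.+ i′) s
    go {h} (s≤s {n = k} i′≤k) eq = begin
      graft (graft (node x l r) (leaves l ℕ.+ i′) s) h u                      ≡⟨ ≡.cong₂ (λ t k → graft t k u) (graft-right x l r s i′) h≡ ⟩
      graft (node x l (graft r i′ s)) (leaves l ℕ.+ (k ℕ.+ leaves s)) u       ≡⟨ graft-right x l (graft r i′ s) u (k ℕ.+ leaves s) ⟩
      node x l (graft (graft r i′ s) (k ℕ.+ leaves s) u)                      ≡⟨ ≡.cong (node x l) (graft-parallel r s u (s≤s i′≤k) j′<r ≡.refl) ⟩
      node x l (graft (graft r (suc k) u) i′ s)                             ≡⟨ graft-right x l (graft r (suc k) u) s i′ ⟨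
      graft (node x l (graft r (suc k) u)) (leaves l ℕ.+ i′) s              ≡⟨ ≡.cong (λ t → graft t (leaves l ℕ.+ i′) s) (graft-right x l r u (suc k)) ⟨
      graft (graft (node x l r) (leaves l ℕ.+ suc k) u) (leaves l ℕ.+ i′) s ∎
      where
      h≡ : h ≡ leaves l ℕ.+ (k ℕ.+ leaves s)
      h≡ = ℕ.suc-injective (≡.trans eq (≡.trans (ℕ.+-assoc (leaves l) (suc k) (leaves s)) (ℕ.+-suc (leaves l) _)))

record TreeOfArity (G : Set g) (n : ℕ) : Set g where
  constructor _,_
  field
    tree   : Tree G
    .arity : leaves tree ≡ n

module _ {G : Set g} where

  private
    index< : ∀ {n k} (i : Fin n) → .(k ≡ n) → toℕ i ℕ.< k
    index< {n} {k} i eq = ≡.subst (toℕ i ℕ.<_) (≡.sym (recompute (k ℕ.≟ n) eq)) (Fin.toℕ<n i)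

  substitute : ∀ {m n k} → TreeOfArity G m → Fin m → TreeOfArity G n →
               .(m ℕ.+ n ≡ suc k) → TreeOfArity G k
  substitute (t , p) i (s , q) e = graft t (toℕ i) s ,
    ℕ.suc-injective (≡.trans (leaves-graft t s (index< i p)) (≡.trans (≡.cong₂ ℕ._+_ p q) e))

  tree-injective : ∀ {n} {t s : TreeOfArity G n} →
                   TreeOfArity.tree t ≡ TreeOfArity.tree s → t ≡ s
  tree-injective {t = _ , _} {s = _ , _} ≡.refl = ≡.refl

  substitute-identityˡ : ∀ {n} (t : TreeOfArity G n) →
                         substitute (leaf , ≡.refl) Fin.zero t ≡.refl ≡ t
  substitute-identityˡ (t , _) = ≡.refl

  substitute-identityʳ : ∀ {n} (t : TreeOfArity G n) i .(e : n ℕ.+ 1 ≡ suc n) →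
                         substitute t i (leaf , ≡.refl) e ≡ t
  substitute-identityʳ (t , p) i e = tree-injective (graft-leaf t (index< i p))

  substitute-sequential :
    ∀ {m n o k q r} (t : TreeOfArity G m) (s : TreeOfArity G n) (u : TreeOfArity G o)
    (i : Fin m) (j : Fin n) (h : Fin k) → toℕ h ≡ toℕ i ℕ.+ toℕ j →
    .(e₁ : m ℕ.+ n ≡ suc k) .(e₂ : k ℕ.+ o ≡ suc r)
    .(e₃ : n ℕ.+ o ≡ suc q) .(e₄ : m ℕ.+ q ≡ suc r) →
    substitute (substitute t i s e₁) h u e₂ ≡ substitute t i (substitute s j u e₃) e₄
  substitute-sequential (t , p) (s , p′) (u , _) i j h eq _ _ _ _ = tree-injective
    (≡.trans (≡.cong (λ k → graft (graft t (toℕ i) s) k u) eq)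
      (graft-sequential t s u (index< i p) (index< j p′)))

  substitute-parallel :
    ∀ {m n o k q r} (t : TreeOfArity G m) (s : TreeOfArity G n) (u : TreeOfArity G o)
    (i j : Fin m) (h : Fin k) (i′ : Fin q) → i Fin.< j →
    suc (toℕ h) ≡ toℕ j ℕ.+ n → toℕ i′ ≡ toℕ i →
    .(e₁ : m ℕ.+ n ≡ suc k) .(e₂ : k ℕ.+ o ≡ suc r)
    .(e₃ : m ℕ.+ o ≡ suc q) .(e₄ : q ℕ.+ n ≡ suc r) →
    substitute (substitute t i s e₁) h u e₂ ≡ substitute (substitute t j u e₃) i′ s e₄
  substitute-parallel {n = n} (t , p) (s , p′) (u , _) i j h i′ i<j eq eq′ _ _ _ _ = tree-injective
    (≡.trans
      (graft-parallel t s u i<j (index< j p)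
        (≡.trans eq (≡.cong (toℕ j ℕ.+_) (≡.sym (recompute (leaves s ℕ.≟ n) p′)))))
      (≡.cong (λ k → graft (graft t (toℕ j) u) k s) (≡.sym eq′)))

------------------------------------------------------------------------

module Operads (K : CommutativeRing c ℓ) where

  open CommutativeRing K using (_≈_; _+_; _*_; -_; 0#; 1#) renaming (Carrier to Scalar)

  ----------------------------------------------------------------------

  module _ (M : Module K m ℓm) where
    open Module M

    data Span (S : Pred Carrierᴹ s) : Pred Carrierᴹ (c ⊔ m ⊔ ℓm ⊔ s) where
      generator : ∀ {x} → x ∈ S → x ∈ Span S
      zero      : 0ᴹ ∈ Span S
      plus      : ∀ {x y} → x ∈ Span S → y ∈ Span S → x +ᴹ y ∈ Span S
      scale     : ∀ a {x} → x ∈ Span S → a *ₗ x ∈ Span S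
      resp      : ∀ {x y} → x ≈ᴹ y → x ∈ Span S → y ∈ Span S

  -- The free module on X: formal linear combinations modulo the
  -- smallest congruence satisfying the module axioms.

  infixl 6 _⊕_
  infixr 7 _⊙_
  infix  4 _≋_

  data Combination (X : Set g) : Set (c ⊔ g) where
    [_] : X → Combination X
    𝟘   : Combination X
    _⊕_ : Combination X → Combination X → Combination X
    _⊙_ : Scalar → Combination X → Combination X

  data _≋_ {X : Set g} : Combination X → Combination X → Set (c ⊔ ℓ ⊔ g) where
    refl      : ∀ {x} → x ≋ x
    sym       : ∀ {x y} → x ≋ y → y ≋ x
    trans     : ∀ {x y z} → x ≋ y → y ≋ z → x ≋ z
    ⊕-cong    : ∀ {x x′ y y′} → x ≋ x′ → y ≋ y′ → x ⊕ y ≋ x′ ⊕ y′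
    ⊙-cong    : ∀ {a b x y} → a ≈ b → x ≋ y → a ⊙ x ≋ b ⊙ y
    ⊕-assoc   : ∀ x y z → (x ⊕ y) ⊕ z ≋ x ⊕ (y ⊕ z)
    ⊕-comm    : ∀ x y → x ⊕ y ≋ y ⊕ x
    ⊕-unit    : ∀ x → 𝟘 ⊕ x ≋ x
    ⊙-zero    : ∀ x → 0# ⊙ x ≋ 𝟘
    ⊙-one     : ∀ x → 1# ⊙ x ≋ x
    ⊙-assoc   : ∀ a b x → (a * b) ⊙ x ≋ a ⊙ b ⊙ x
    ⊙-distrib : ∀ a x y → a ⊙ (x ⊕ y) ≋ a ⊙ x ⊕ a ⊙ y
    +-distrib : ∀ a b x → (a + b) ⊙ x ≋ a ⊙ x ⊕ b ⊙ x

  module _ (X : Set g) where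

    private
      zeroʳ : ∀ a → a ⊙ 𝟘 {X = X} ≋ 𝟘
      zeroʳ a = trans (⊙-cong (CommutativeRing.refl K) (sym (⊙-zero 𝟘)))
        (trans (sym (⊙-assoc a 0# 𝟘))
        (trans (⊙-cong (CommutativeRing.zeroʳ K a) refl) (⊙-zero 𝟘)))

      inverseʳ : ∀ (x : Combination X) → x ⊕ (- 1#) ⊙ x ≋ 𝟘
      inverseʳ x = trans (⊕-cong (sym (⊙-one x)) refl)
        (trans (sym (+-distrib 1# (- 1#) x))
        (trans (⊙-cong (CommutativeRing.-‿inverseʳ K 1#) refl) (⊙-zero x)))

    freeModule : Module K (c ⊔ g) (c ⊔ ℓ ⊔ g)
    freeModule = record
      { Carrierᴹ = Combination X
      ; _≈ᴹ_     = _≋_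
      ; _+ᴹ_     = _⊕_
      ; _*ₗ_     = _⊙_
      ; _*ᵣ_     = flip _⊙_
      ; 0ᴹ       = 𝟘
      ; -ᴹ_      = (- 1#) ⊙_
      ; isModule = IsModuleFromLeft.isModule {commutativeRing = K} (record
        { isLeftModule = record
          { isLeftSemimodule = record
            { +ᴹ-isCommutativeMonoid = record
              { isMonoid = record
                { isSemigroup = record
                  { isMagma = record
                    { isEquivalence = record { refl = refl ; sym = sym ; trans = trans }
                    ; ∙-cong        = ⊕-cong
                    }
                  ; assoc = ⊕-assoc
                  }
                ; identity = ⊕-unit , λ x → trans (⊕-comm x 𝟘) (⊕-unit x)
                }
              ; comm = ⊕-comm
              }
            ; isPreleftSemimodule = record
              { *ₗ-cong      = ⊙-cong
              ; *ₗ-zeroˡ     = ⊙-zero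
              ; *ₗ-distribʳ  = λ x a b → +-distrib a b x
              ; *ₗ-identityˡ = ⊙-one
              ; *ₗ-assoc     = ⊙-assoc
              ; *ₗ-zeroʳ     = zeroʳ
              ; *ₗ-distribˡ  = ⊙-distrib
              }
            }
          ; -ᴹ‿cong    = ⊙-cong (CommutativeRing.refl K)
          ; -ᴹ‿inverse = (λ x → trans (⊕-comm _ x) (inverseʳ x)) , inverseʳ
          }
        })
      }

  module _ (M : Module K m ℓm) where
    open Module M

    extend : {X : Set g} → (X → Carrierᴹ) → Combination X → Carrierᴹ
    extend f [ x ]   = f x
    extend f 𝟘       = 0ᴹ
    extend f (x ⊕ y) = extend f x +ᴹ extend f y
    extend f (a ⊙ x) = a *ₗ extend f x

    extend-cong : {X : Set g} (f : X → Carrierᴹ) {x y : Combination X} →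
                  x ≋ y → extend f x ≈ᴹ extend f y
    extend-cong f refl                 = ≈ᴹ-refl
    extend-cong f (sym e)              = ≈ᴹ-sym (extend-cong f e)
    extend-cong f (trans e e′)         = ≈ᴹ-trans (extend-cong f e) (extend-cong f e′)
    extend-cong f (⊕-cong e e′)        = +ᴹ-cong (extend-cong f e) (extend-cong f e′)
    extend-cong f (⊙-cong a e)         = *ₗ-cong a (extend-cong f e)
    extend-cong f (⊕-assoc x y z)      = +ᴹ-assoc _ _ _
    extend-cong f (⊕-comm x y)         = +ᴹ-comm _ _
    extend-cong f (⊕-unit x)           = +ᴹ-identityˡ _
    extend-cong f (⊙-zero x)           = *ₗ-zeroˡ _
    extend-cong f (⊙-one x)            = *ₗ-identityˡ _
    extend-cong f (⊙-assoc a b x)      = *ₗ-assoc a b _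
    extend-cong f (⊙-distrib a x y)    = *ₗ-distribˡ a _ _
    extend-cong f (+-distrib a b x)    = *ₗ-distribʳ _ a b

    extend₂ : {X Y : Set g} → (X → Y → Carrierᴹ) → Combination X → Combination Y → Carrierᴹ
    extend₂ f x y = extend (λ s → extend (f s) y) x

    record IsLinear {X : Set g} (F : Combination X → Carrierᴹ) : Set (c ⊔ ℓ ⊔ g ⊔ ℓm) where
      field
        cong    : ∀ {x y} → x ≋ y → F x ≈ᴹ F y
        0-homo  : F 𝟘 ≈ᴹ 0ᴹ
        +-homo  : ∀ x y → F (x ⊕ y) ≈ᴹ F x +ᴹ F y
        *ₗ-homo : ∀ a x → F (a ⊙ x) ≈ᴹ a *ₗ F x

    linear-unique : {X : Set g} {F F′ : Combination X → Carrierᴹ} →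
                    IsLinear F → IsLinear F′ →
                    (∀ x → F [ x ] ≈ᴹ F′ [ x ]) → ∀ x → F x ≈ᴹ F′ x
    linear-unique {F = F} {F′} lin lin′ basis = go
      where
      module L  = IsLinear lin
      module L′ = IsLinear lin′
      go : ∀ x → F x ≈ᴹ F′ x
      go [ x ]   = basis x
      go 𝟘       = ≈ᴹ-trans L.0-homo (≈ᴹ-sym L′.0-homo)
      go (x ⊕ y) = ≈ᴹ-trans (L.+-homo x y) (≈ᴹ-trans (+ᴹ-cong (go x) (go y)) (≈ᴹ-sym (L′.+-homo x y)))
      go (a ⊙ x) = ≈ᴹ-trans (L.*ₗ-homo a x)
        (≈ᴹ-trans (*ₗ-cong (CommutativeRing.refl K) (go x)) (≈ᴹ-sym (L′.*ₗ-homo a x)))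

    extend-isLinear : {X : Set g} (f : X → Carrierᴹ) → IsLinear (extend f)
    extend-isLinear f = record
      { cong = extend-cong f ; 0-homo = ≈ᴹ-refl
      ; +-homo = λ _ _ → ≈ᴹ-refl ; *ₗ-homo = λ _ _ → ≈ᴹ-refl }

    extend-pointwise : {X : Set g} {f f′ : X → Carrierᴹ} → (∀ x → f x ≈ᴹ f′ x) →
                       ∀ x → extend f x ≈ᴹ extend f′ x
    extend-pointwise {f = f} {f′} = linear-unique (extend-isLinear f) (extend-isLinear f′)

    extend₂-isLinearˡ : {X Y : Set g} (f : X → Y → Carrierᴹ) (y : Combination Y) →
                        IsLinear (λ x → extend₂ f x y)
    extend₂-isLinearˡ f y = extend-isLinear (λ s → extend (f s) y)

    extend₂-isLinearʳ : {X Y : Set g} (f : X → Y → Carrierᴹ) (x : Combination X) →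
                        IsLinear (extend₂ f x)
    extend₂-isLinearʳ f x = record
      { cong    = λ e → extend-pointwise (λ s → extend-cong (f s) e) x
      ; 0-homo  = zeros x
      ; +-homo  = λ y z → sums y z x
      ; *ₗ-homo = λ a y → scalars a y x
      }
      where
      open CommutativeSemigroupProperties
        (CommutativeMonoid.commutativeSemigroup +ᴹ-commutativeMonoid) using (interchange)
      zeros : ∀ x → extend₂ f x 𝟘 ≈ᴹ 0ᴹ
      zeros [ _ ]   = ≈ᴹ-refl
      zeros 𝟘       = ≈ᴹ-refl
      zeros (x ⊕ y) = ≈ᴹ-trans (+ᴹ-cong (zeros x) (zeros y)) (+ᴹ-identityˡ 0ᴹ)
      zeros (a ⊙ x) = ≈ᴹ-trans (*ₗ-cong (CommutativeRing.refl K) (zeros x)) (*ₗ-zeroʳ a)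
      sums : ∀ y z x → extend₂ f x (y ⊕ z) ≈ᴹ extend₂ f x y +ᴹ extend₂ f x z
      sums y z [ _ ]    = ≈ᴹ-refl
      sums y z 𝟘        = ≈ᴹ-sym (+ᴹ-identityˡ 0ᴹ)
      sums y z (x ⊕ x′) = ≈ᴹ-trans (+ᴹ-cong (sums y z x) (sums y z x′)) (interchange _ _ _ _)
      sums y z (a ⊙ x)  = ≈ᴹ-trans (*ₗ-cong (CommutativeRing.refl K) (sums y z x)) (*ₗ-distribˡ a _ _)
      scalars : ∀ a y x → extend₂ f x (a ⊙ y) ≈ᴹ a *ₗ extend₂ f x y
      scalars a y [ _ ]    = ≈ᴹ-refl
      scalars a y 𝟘        = ≈ᴹ-sym (*ₗ-zeroʳ a)
      scalars a y (x ⊕ x′) = ≈ᴹ-trans (+ᴹ-cong (scalars a y x) (scalars a y x′)) (≈ᴹ-sym (*ₗ-distribˡ a _ _))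
      scalars a y (b ⊙ x)  = ≈ᴹ-trans (*ₗ-cong (CommutativeRing.refl K) (scalars a y x)) (*ₗ-comm b a _)

  ∘-isLinear : (M : Module K m ℓm) {X Y : Set g}
               {F : Combination X → Combination Y} {F′ : Combination Y → Module.Carrierᴹ M} →
               IsLinear M F′ → IsLinear (freeModule Y) F → IsLinear M (F′ ∘ F)
  ∘-isLinear M {F = F} lin′ lin = record
    { cong    = L′.cong ∘ L.cong
    ; 0-homo  = ≈ᴹ-trans (L′.cong L.0-homo) L′.0-homo
    ; +-homo  = λ x y → ≈ᴹ-trans (L′.cong (L.+-homo x y)) (L′.+-homo _ _)
    ; *ₗ-homo = λ a x → ≈ᴹ-trans (L′.cong (L.*ₗ-homo a x)) (L′.*ₗ-homo a _)
    }
    where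
    open Module M
    module L  = IsLinear lin
    module L′ = IsLinear lin′

  ----------------------------------------------------------------------

  -- Inputs are numbered from 0.  A composite of operations of arities m
  -- and n has arity m + n - 1; it is allowed to live in any arity k with
  -- m + n ≡ suc k, so that no transport is needed in the axioms.

  record Operad (m ℓm : Level) : Set (c ⊔ ℓ ⊔ Level.suc (m ⊔ ℓm)) where
    infix  10 _∘[_]_⟨_⟩
    infixl 9 _∘₁_ _∘₂_

    field
      space : ℕ → Module K m ℓm

    Op : ℕ → Set m
    Op n = Module.Carrierᴹ (space n)

    open module Space {n : ℕ} = Module (space n) hiding (Carrierᴹ) public

    field
      𝟙         : Op 1
      _∘[_]_⟨_⟩ : ∀ {m n k} → Op m → Fin m → Op n → .(m ℕ.+ n ≡ suc k) → Op k

      ∘-cong : ∀ {m n k} {x x′ : Op m} {y y′ : Op n} (i : Fin m) .(e : m ℕ.+ n ≡ suc k) →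
               x ≈ᴹ x′ → y ≈ᴹ y′ → x ∘[ i ] y ⟨ e ⟩ ≈ᴹ x′ ∘[ i ] y′ ⟨ e ⟩
      ∘-+ˡ   : ∀ {m n k} (x x′ : Op m) (i : Fin m) (y : Op n) .(e : m ℕ.+ n ≡ suc k) →
               (x +ᴹ x′) ∘[ i ] y ⟨ e ⟩ ≈ᴹ x ∘[ i ] y ⟨ e ⟩ +ᴹ x′ ∘[ i ] y ⟨ e ⟩
      ∘-+ʳ   : ∀ {m n k} (x : Op m) (i : Fin m) (y y′ : Op n) .(e : m ℕ.+ n ≡ suc k) →
               x ∘[ i ] (y +ᴹ y′) ⟨ e ⟩ ≈ᴹ x ∘[ i ] y ⟨ e ⟩ +ᴹ x ∘[ i ] y′ ⟨ e ⟩
      ∘-*ₗˡ  : ∀ {m n k} a (x : Op m) (i : Fin m) (y : Op n) .(e : m ℕ.+ n ≡ suc k) →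
               (a *ₗ x) ∘[ i ] y ⟨ e ⟩ ≈ᴹ a *ₗ (x ∘[ i ] y ⟨ e ⟩)
      ∘-*ₗʳ  : ∀ {m n k} a (x : Op m) (i : Fin m) (y : Op n) .(e : m ℕ.+ n ≡ suc k) →
               x ∘[ i ] (a *ₗ y) ⟨ e ⟩ ≈ᴹ a *ₗ (x ∘[ i ] y ⟨ e ⟩)

      ∘-identityˡ  : ∀ {n} (x : Op n) → 𝟙 ∘[ Fin.zero ] x ⟨ ≡.refl ⟩ ≈ᴹ x
      ∘-identityʳ  : ∀ {n} (x : Op n) (i : Fin n) .(e : n ℕ.+ 1 ≡ suc n) →
                     x ∘[ i ] 𝟙 ⟨ e ⟩ ≈ᴹ x
      ∘-sequential :
        ∀ {m n o k q r} (x : Op m) (y : Op n) (z : Op o)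
        (i : Fin m) (j : Fin n) (h : Fin k) → toℕ h ≡ toℕ i ℕ.+ toℕ j →
        .(e₁ : m ℕ.+ n ≡ suc k) .(e₂ : k ℕ.+ o ≡ suc r)
        .(e₃ : n ℕ.+ o ≡ suc q) .(e₄ : m ℕ.+ q ≡ suc r) →
        (x ∘[ i ] y ⟨ e₁ ⟩) ∘[ h ] z ⟨ e₂ ⟩ ≈ᴹ x ∘[ i ] (y ∘[ j ] z ⟨ e₃ ⟩) ⟨ e₄ ⟩
      ∘-parallel   :
        ∀ {m n o k q r} (x : Op m) (y : Op n) (z : Op o)
        (i j : Fin m) (h : Fin k) (i′ : Fin q) → i Fin.< j →
        suc (toℕ h) ≡ toℕ j ℕ.+ n → toℕ i′ ≡ toℕ i →
        .(e₁ : m ℕ.+ n ≡ suc k) .(e₂ : k ℕ.+ o ≡ suc r)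
        .(e₃ : m ℕ.+ o ≡ suc q) .(e₄ : q ℕ.+ n ≡ suc r) →
        (x ∘[ i ] y ⟨ e₁ ⟩) ∘[ h ] z ⟨ e₂ ⟩ ≈ᴹ (x ∘[ j ] z ⟨ e₃ ⟩) ∘[ i′ ] y ⟨ e₄ ⟩

    _∘₁_ _∘₂_ : Op 2 → Op 2 → Op 3
    x ∘₁ y = x ∘[ Fin.zero ] y ⟨ ≡.refl ⟩
    x ∘₂ y = x ∘[ Fin.suc Fin.zero ] y ⟨ ≡.refl ⟩

    ∑ : ∀ {n k} → (Fin k → Op n) → Op n
    ∑ = RawMonoidDefs.sum +ᴹ-rawMonoid

  record OperadIsomorphism (O : Operad m ℓm) (P : Operad p ℓp)
                           : Set (c ⊔ m ⊔ ℓm ⊔ p ⊔ ℓp) where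
    private
      module O = Operad O
      module P = Operad P
    field
      ⟦_⟧ : ∀ {n} → O.Op n → P.Op n
      isModuleIsomorphism : ∀ {n} →
        IsModuleIsomorphism (Module.rawModule (O.space n)) (Module.rawModule (P.space n)) ⟦_⟧
      𝟙-homo : ⟦ O.𝟙 ⟧ P.≈ᴹ P.𝟙
      ∘-homo : ∀ {m n k} (x : O.Op m) (i : Fin m) (y : O.Op n) .(e : m ℕ.+ n ≡ suc k) →
               ⟦ x O.∘[ i ] y ⟨ e ⟩ ⟧ P.≈ᴹ ⟦ x ⟧ P.∘[ i ] ⟦ y ⟧ ⟨ e ⟩

  ----------------------------------------------------------------------

  module _ (O : Operad m ℓm) where
    open Operad O

    data Ideal {k} (S : Pred (Op k) s) : ∀ {n} → Pred (Op n) (c ⊔ m ⊔ ℓm ⊔ s) where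
      generator : ∀ {x} → x ∈ S → x ∈ Ideal S
      zero      : ∀ {n} → 0ᴹ {n} ∈ Ideal S
      plus      : ∀ {n} {x y : Op n} → x ∈ Ideal S → y ∈ Ideal S → x +ᴹ y ∈ Ideal S
      scale     : ∀ {n} a {x : Op n} → x ∈ Ideal S → a *ₗ x ∈ Ideal S
      resp      : ∀ {n} {x y : Op n} → x ≈ᴹ y → x ∈ Ideal S → y ∈ Ideal S
      compˡ     : ∀ {m n k} {x : Op m} (i : Fin m) (y : Op n) .(e : m ℕ.+ n ≡ suc k) →
                  x ∈ Ideal S → x ∘[ i ] y ⟨ e ⟩ ∈ Ideal S
      compʳ     : ∀ {m n k} (x : Op m) (i : Fin m) {y : Op n} .(e : m ℕ.+ n ≡ suc k) →
                  y ∈ Ideal S → x ∘[ i ] y ⟨ e ⟩ ∈ Ideal S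

    module _ {k} (S : Pred (Op k) s) where

      infix 4 _∼_

      _∼_ : ∀ {n} → Op n → Op n → Set (c ⊔ m ⊔ ℓm ⊔ s)
      x ∼ y = (x +ᴹ -ᴹ y) ∈ Ideal S

      private
        module G {n} = AbelianGroupProperties (+ᴹ-abelianGroup {n})
        module C {n} = CommutativeSemigroupProperties
          (CommutativeMonoid.commutativeSemigroup (+ᴹ-commutativeMonoid {n}))

      -1*x : ∀ {n} (x : Op n) → (- 1#) *ₗ x ≈ᴹ -ᴹ x
      -1*x x = G.inverseʳ-unique x ((- 1#) *ₗ x)
        (≈ᴹ-trans (+ᴹ-cong (≈ᴹ-sym (*ₗ-identityˡ x)) ≈ᴹ-refl)
        (≈ᴹ-trans (≈ᴹ-sym (*ₗ-distribʳ x 1# (- 1#)))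
        (≈ᴹ-trans (*ₗ-cong (CommutativeRing.-‿inverseʳ K 1#) ≈ᴹ-refl) (*ₗ-zeroˡ x))))

      negate : ∀ {n} {x : Op n} → x ∈ Ideal S → (-ᴹ x) ∈ Ideal S
      negate {x = x} x∈I = resp (-1*x x) (scale (- 1#) x∈I)

      ≈⇒∼ : ∀ {n} {x y : Op n} → x ≈ᴹ y → x ∼ y
      ≈⇒∼ {x = x} {y} x≈y =
        resp (≈ᴹ-sym (≈ᴹ-trans (+ᴹ-cong x≈y ≈ᴹ-refl) (-ᴹ‿inverseʳ y))) zero

      ∼-sym : ∀ {n} {x y : Op n} → x ∼ y → y ∼ x
      ∼-sym {x = x} {y} r = resp
        (≈ᴹ-trans (≈ᴹ-sym (G.⁻¹-∙-comm x (-ᴹ y)))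
        (≈ᴹ-trans (+ᴹ-cong ≈ᴹ-refl (G.⁻¹-involutive y)) (+ᴹ-comm _ _)))
        (negate r)

      ∼-trans : ∀ {n} {x y z : Op n} → x ∼ y → y ∼ z → x ∼ z
      ∼-trans {x = x} {y} {z} r r′ = resp
        (≈ᴹ-trans (+ᴹ-assoc x (-ᴹ y) _)
        (+ᴹ-cong ≈ᴹ-refl
          (≈ᴹ-trans (≈ᴹ-sym (+ᴹ-assoc (-ᴹ y) y _))
          (≈ᴹ-trans (+ᴹ-cong (-ᴹ‿inverseˡ y) ≈ᴹ-refl) (+ᴹ-identityˡ _)))))
        (plus r r′)

      +-∼ : ∀ {n} {x x′ y y′ : Op n} → x ∼ x′ → y ∼ y′ → x +ᴹ y ∼ x′ +ᴹ y′
      +-∼ {x = x} {x′} {y} {y′} r r′ = resp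
        (≈ᴹ-trans (C.interchange x (-ᴹ x′) y (-ᴹ y′))
          (+ᴹ-cong ≈ᴹ-refl (G.⁻¹-∙-comm x′ y′)))
        (plus r r′)

      neg-homo : ∀ {n n′} (F : Op n → Op n′) → (∀ {x y} → x ≈ᴹ y → F x ≈ᴹ F y) →
                 (∀ a x → F (a *ₗ x) ≈ᴹ a *ₗ F x) → ∀ x → F (-ᴹ x) ≈ᴹ -ᴹ F x
      neg-homo F F-cong F-* x = ≈ᴹ-trans (F-cong (≈ᴹ-sym (-1*x x)))
        (≈ᴹ-trans (F-* (- 1#) x) (-1*x (F x)))

      *ₗ-∼ : ∀ {n} {a b} {x y : Op n} → a ≈ b → x ∼ y → a *ₗ x ∼ b *ₗ y
      *ₗ-∼ {a = a} {b} {x} {y} a≈b r = ∼-trans (≈⇒∼ (*ₗ-cong a≈b ≈ᴹ-refl)) (resp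
        (≈ᴹ-trans (*ₗ-distribˡ b x (-ᴹ y))
          (+ᴹ-cong ≈ᴹ-refl (neg-homo (b *ₗ_) (*ₗ-cong (CommutativeRing.refl K)) (*ₗ-comm b) y)))
        (scale b r))

      -‿∼ : ∀ {n} {x y : Op n} → x ∼ y → -ᴹ x ∼ -ᴹ y
      -‿∼ {x = x} {y} r = ∼-trans (≈⇒∼ (≈ᴹ-sym (-1*x x)))
        (∼-trans (*ₗ-∼ (CommutativeRing.refl K) r) (≈⇒∼ (-1*x y)))

      ∘-∼ : ∀ {m n k} {x x′ : Op m} {y y′ : Op n} (i : Fin m) .(e : m ℕ.+ n ≡ suc k) →
            x ∼ x′ → y ∼ y′ → x ∘[ i ] y ⟨ e ⟩ ∼ x′ ∘[ i ] y′ ⟨ e ⟩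
      ∘-∼ {x = x} {x′} {y} {y′} i e r r′ = ∼-trans
        (resp (≈ᴹ-trans (∘-+ˡ x (-ᴹ x′) i y e) (+ᴹ-cong ≈ᴹ-refl
                (neg-homo (λ z → z ∘[ i ] y ⟨ e ⟩) (λ z≈ → ∘-cong i e z≈ ≈ᴹ-refl)
                  (λ a z → ∘-*ₗˡ a z i y e) x′)))
              (compˡ i y e r))
        (resp (≈ᴹ-trans (∘-+ʳ x′ i y (-ᴹ y′) e) (+ᴹ-cong ≈ᴹ-refl
                (neg-homo (λ z → x′ ∘[ i ] z ⟨ e ⟩) (λ z≈ → ∘-cong i e ≈ᴹ-refl z≈)
                  (λ a z → ∘-*ₗʳ a x′ i z e) y′)))
              (compʳ x′ i e r′))

      infix 5 _/⟨_⟩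

      -- The quotient O/⟨S⟩ has the same carriers as O, with coarser equality.
      _/⟨_⟩ : Operad m (c ⊔ m ⊔ ℓm ⊔ s)
      _/⟨_⟩ = record
        { space = λ n → record
          { Carrierᴹ = Op n
          ; _≈ᴹ_     = _∼_
          ; _+ᴹ_     = _+ᴹ_
          ; _*ₗ_     = _*ₗ_
          ; _*ᵣ_     = flip _*ₗ_
          ; 0ᴹ       = 0ᴹ
          ; -ᴹ_      = -ᴹ_
          ; isModule = IsModuleFromLeft.isModule {commutativeRing = K} (record
            { isLeftModule = record
              { isLeftSemimodule = record
                { +ᴹ-isCommutativeMonoid = record
                  { isMonoid = record
                    { isSemigroup = record
                      { isMagma = record
                        { isEquivalence = record { refl = ≈⇒∼ ≈ᴹ-refl ; sym = ∼-sym ; trans = ∼-trans }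
                        ; ∙-cong        = +-∼
                        }
                      ; assoc = λ x y z → ≈⇒∼ (+ᴹ-assoc x y z)
                      }
                    ; identity = (λ x → ≈⇒∼ (+ᴹ-identityˡ x)) , (λ x → ≈⇒∼ (+ᴹ-identityʳ x))
                    }
                  ; comm = λ x y → ≈⇒∼ (+ᴹ-comm x y)
                  }
                ; isPreleftSemimodule = record
                  { *ₗ-cong      = *ₗ-∼
                  ; *ₗ-zeroˡ     = λ x → ≈⇒∼ (*ₗ-zeroˡ x)
                  ; *ₗ-distribʳ  = λ x a b → ≈⇒∼ (*ₗ-distribʳ x a b)
                  ; *ₗ-identityˡ = λ x → ≈⇒∼ (*ₗ-identityˡ x)
                  ; *ₗ-assoc     = λ a b x → ≈⇒∼ (*ₗ-assoc a b x)
                  ; *ₗ-zeroʳ     = λ a → ≈⇒∼ (*ₗ-zeroʳ a)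
                  ; *ₗ-distribˡ  = λ a x y → ≈⇒∼ (*ₗ-distribˡ a x y)
                  }
                }
              ; -ᴹ‿cong    = -‿∼
              ; -ᴹ‿inverse = (λ x → ≈⇒∼ (-ᴹ‿inverseˡ x)) , (λ x → ≈⇒∼ (-ᴹ‿inverseʳ x))
              }
            })
          }
        ; 𝟙            = 𝟙
        ; _∘[_]_⟨_⟩    = _∘[_]_⟨_⟩
        ; ∘-cong       = ∘-∼
        ; ∘-+ˡ         = λ x x′ i y e → ≈⇒∼ (∘-+ˡ x x′ i y e)
        ; ∘-+ʳ         = λ x i y y′ e → ≈⇒∼ (∘-+ʳ x i y y′ e)
        ; ∘-*ₗˡ        = λ a x i y e → ≈⇒∼ (∘-*ₗˡ a x i y e)
        ; ∘-*ₗʳ        = λ a x i y e → ≈⇒∼ (∘-*ₗʳ a x i y e)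
        ; ∘-identityˡ  = λ x → ≈⇒∼ (∘-identityˡ x)
        ; ∘-identityʳ  = λ x i e → ≈⇒∼ (∘-identityʳ x i e)
        ; ∘-sequential = λ x y z i j h eq e₁ e₂ e₃ e₄ →
            ≈⇒∼ (∘-sequential x y z i j h eq e₁ e₂ e₃ e₄)
        ; ∘-parallel   = λ x y z i j h i′ i<j eq eq′ e₁ e₂ e₃ e₄ →
            ≈⇒∼ (∘-parallel x y z i j h i′ i<j eq eq′ e₁ e₂ e₃ e₄)
        }

  ----------------------------------------------------------------------

  module _ (G : Set g) where

    private
      F : ℕ → Module K (c ⊔ g) (c ⊔ ℓ ⊔ g)
      F n = freeModule (TreeOfArity G n)

      [_]-cong : ∀ {n} {s t : TreeOfArity G n} → s ≡ t → [ s ] ≋ [ t ]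
      [ ≡.refl ]-cong = refl

      comp : ∀ {m n k} → Combination (TreeOfArity G m) → Fin m →
             Combination (TreeOfArity G n) → .(m ℕ.+ n ≡ suc k) →
             Combination (TreeOfArity G k)
      comp {k = k} x i y e = extend₂ (F k) (λ s t → [ substitute s i t e ]) x y

      linˡ : ∀ {m n k} (i : Fin m) (y : Combination (TreeOfArity G n)) .(e : m ℕ.+ n ≡ suc k) →
             IsLinear (F k) (λ x → comp x i y e)
      linˡ {k = k} i y e = extend₂-isLinearˡ (F k) _ y

      linʳ : ∀ {m n k} (x : Combination (TreeOfArity G m)) (i : Fin m) .(e : m ℕ.+ n ≡ suc k) →
             IsLinear (F k) (λ (y : Combination (TreeOfArity G n)) → comp x i y e)
      linʳ {k = k} x i e = extend₂-isLinearʳ (F k) _ x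

      id-isLinear : ∀ {n} → IsLinear (F n) (λ x → x)
      id-isLinear = record
        { cong = λ e → e ; 0-homo = refl ; +-homo = λ _ _ → refl ; *ₗ-homo = λ _ _ → refl }

    Free : Operad (c ⊔ g) (c ⊔ ℓ ⊔ g)
    Free = record
      { space        = F
      ; 𝟙            = [ leaf , ≡.refl ]
      ; _∘[_]_⟨_⟩    = comp
      ; ∘-cong       = λ {_} {_} {_} {x} {x′} {y} {y′} i e x≋x′ y≋y′ →
          trans (IsLinear.cong (linˡ i y e) x≋x′) (IsLinear.cong (linʳ x′ i e) y≋y′)
      ; ∘-+ˡ         = λ x x′ i y e → IsLinear.+-homo (linˡ i y e) x x′
      ; ∘-+ʳ         = λ x i y y′ e → IsLinear.+-homo (linʳ x i e) y y′
      ; ∘-*ₗˡ        = λ a x i y e → IsLinear.*ₗ-homo (linˡ i y e) a x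
      ; ∘-*ₗʳ        = λ a x i y e → IsLinear.*ₗ-homo (linʳ x i e) a y
      ; ∘-identityˡ  = λ {n} → linear-unique (F n) (linʳ [ leaf , ≡.refl ] Fin.zero ≡.refl) id-isLinear
          (λ s → [ substitute-identityˡ s ]-cong)
      ; ∘-identityʳ  = λ {n} x i e → linear-unique (F n) (linˡ i [ leaf , ≡.refl ] e) id-isLinear
          (λ s → [ substitute-identityʳ s i e ]-cong) x
      ; ∘-sequential = λ {_} {_} {_} {_} {_} {r} x y z i j h eq e₁ e₂ e₃ e₄ →
          linear-unique (F r)
            (∘-isLinear (F r) (linˡ h z e₂) (linˡ i y e₁))
            (linˡ i (comp y j z e₃) e₄)
            (λ s → linear-unique (F r)
              (∘-isLinear (F r) (linˡ h z e₂) (linʳ [ s ] i e₁))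
              (∘-isLinear (F r) (linʳ [ s ] i e₄) (linˡ j z e₃))
              (λ t → linear-unique (F r)
                (linʳ (comp [ s ] i [ t ] e₁) h e₂)
                (∘-isLinear (F r) (linʳ [ s ] i e₄) (linʳ [ t ] j e₃))
                (λ u → [ substitute-sequential s t u i j h eq e₁ e₂ e₃ e₄ ]-cong) z) y) x
      ; ∘-parallel   = λ {_} {_} {_} {_} {_} {r} x y z i j h i′ i<j eq eq′ e₁ e₂ e₃ e₄ →
          linear-unique (F r)
            (∘-isLinear (F r) (linˡ h z e₂) (linˡ i y e₁))
            (∘-isLinear (F r) (linˡ i′ y e₄) (linˡ j z e₃))
            (λ s → linear-unique (F r)
              (∘-isLinear (F r) (linˡ h z e₂) (linʳ [ s ] i e₁))
              (linʳ (comp [ s ] j z e₃) i′ e₄)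
              (λ t → linear-unique (F r)
                (linʳ (comp [ s ] i [ t ] e₁) h e₂)
                (∘-isLinear (F r) (linˡ i′ [ t ] e₄) (linʳ [ s ] j e₃))
                (λ u → [ substitute-parallel s t u i j h i′ i<j eq eq′ e₁ e₂ e₃ e₄ ]-cong) z) y) x
      }

  gen : {G : Set g} → G → Operad.Op (Free G) 2
  gen x = [ node x leaf leaf , ≡.refl ]

  Presentation : Operad p ℓp → {G : Set g} → Pred (Operad.Op (Free G) 3) s →
                 Set (c ⊔ ℓ ⊔ g ⊔ s ⊔ p ⊔ ℓp)
  Presentation O {G} R = OperadIsomorphism (Free G /⟨ R ⟩) O

  ----------------------------------------------------------------------

  module _ {G : Set g} (_≟_ : DecidableEquality G) where

    -- The basis of Free(G)(3) consists of
    --   gen x ∘₁ gen y = node x (node y leaf leaf) leaf  and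
    --   gen x ∘₂ gen y = node x leaf (node y leaf leaf).
    treePairing : Tree G → Tree G → Scalar
    treePairing (node x (node y leaf leaf) leaf) (node x′ (node y′ leaf leaf) leaf) =
      if does (x ≟ x′) ∧ does (y ≟ y′) then 1# else 0#
    treePairing (node x leaf (node y leaf leaf)) (node x′ leaf (node y′ leaf leaf)) =
      if does (x ≟ x′) ∧ does (y ≟ y′) then - 1# else 0#
    treePairing _ _ = 0#

    pairing : Operad.Op (Free G) 3 → Operad.Op (Free G) 3 → Scalar
    pairing = extend₂ TensorUnit.⟨module⟩
      (λ s t → treePairing (TreeOfArity.tree s) (TreeOfArity.tree t))

    Annihilator : Pred (Operad.Op (Free G) 3) s → Pred (Operad.Op (Free G) 3) (c ⊔ ℓ ⊔ g ⊔ s)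
    Annihilator R f = ∀ r → r ∈ R → pairing r f ≈ 0#

    KoszulDual : Pred (Operad.Op (Free G) 3) s → Operad (c ⊔ g) (c ⊔ ℓ ⊔ g ⊔ s)
    KoszulDual R = Free G /⟨ Annihilator R ⟩

------------------------------------------------------------------------
-- The set [γ] = {1, …, γ} is represented by Fin γ, with a : Fin γ
-- standing for the integer toℕ a + 1.

data DiasGen (γ : ℕ) : Set where
  ⊣ ⊢ : Fin γ → DiasGen γ

-- The Koszul dual is formed on the same generators, under other names.
pattern ↼ a = ⊣ a
pattern ⇀ a = ⊢ a

data DendrGen (γ : ℕ) : Set where
  ≺ ≻ : Fin γ → DendrGen γ

_≟ᴰ_ : ∀ {γ} → DecidableEquality (DiasGen γ)
⊣ a ≟ᴰ ⊣ b = map′ (≡.cong ⊣) (λ { ≡.refl → ≡.refl }) (a Fin.≟ b)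
⊣ a ≟ᴰ ⊢ b = no λ ()
⊢ a ≟ᴰ ⊣ b = no λ ()
⊢ a ≟ᴰ ⊢ b = map′ (≡.cong ⊢) (λ { ≡.refl → ≡.refl }) (a Fin.≟ b)

infixl 6 _↑_

_↑_ : ∀ {γ} → Fin γ → Fin γ → Fin γ
_↑_ {γ} = Max._⊔_ (Fin.≤-totalOrder γ)

module PolydendriformOperads (K : CommutativeRing c ℓ) (γ : ℕ) where
  open Operads K public

  module _ where
    open Operad (Free (DiasGen γ))

    data DiasRelator : Pred (Op 3) c where
      ⊣∘⊢ : ∀ a a′ → DiasRelator (gen (⊣ a) ∘₁ gen (⊢ a′) +ᴹ -ᴹ gen (⊢ a′) ∘₂ gen (⊣ a))
      ⊣∘⊣ : ∀ a a′ → DiasRelator (gen (⊣ a) ∘₁ gen (⊣ (a ↑ a′)) +ᴹ -ᴹ gen (⊣ a) ∘₂ gen (⊢ a′))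
      ⊢∘⊣ : ∀ a a′ → DiasRelator (gen (⊢ a) ∘₁ gen (⊣ a′) +ᴹ -ᴹ gen (⊢ a) ∘₂ gen (⊢ (a ↑ a′)))
      ⊣↑∘⊣ : ∀ a a′ → DiasRelator (gen (⊣ (a ↑ a′)) ∘₁ gen (⊣ a) +ᴹ -ᴹ gen (⊣ a) ∘₂ gen (⊣ a′))
      ⊢∘⊢ : ∀ a a′ → DiasRelator (gen (⊢ a) ∘₁ gen (⊢ a′) +ᴹ -ᴹ gen (⊢ (a ↑ a′)) ∘₂ gen (⊢ a))

    DiasRelations : Pred (Op 3) (c ⊔ ℓ)
    DiasRelations = Span (space 3) DiasRelator

    ∑↼ ∑⇀ : Fin γ → Op 2
    ∑↼ b = ∑ {k = suc (toℕ b)} λ a → gen (↼ (inject≤ a (Fin.toℕ<n b)))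
    ∑⇀ b = ∑ {k = suc (toℕ b)} λ a → gen (⇀ (inject≤ a (Fin.toℕ<n b)))

  Dias : Operad c (c ⊔ ℓ)
  Dias = Free (DiasGen γ) /⟨ DiasRelations ⟩

  Dendr : Operad c (c ⊔ ℓ)
  Dendr = KoszulDual _≟ᴰ_ DiasRelations

  module _ where
    open Operad (Free (DendrGen γ))

    data DendrRelator : Pred (Op 3) c where
      rel₁ : ∀ a a′ → DendrRelator
        (gen (≺ a) ∘₁ gen (≻ a′) +ᴹ -ᴹ gen (≻ a′) ∘₂ gen (≺ a))
      rel₂ : ∀ {a b} → a Fin.< b → DendrRelator
        (gen (≺ a) ∘₁ gen (≺ b) +ᴹ -ᴹ gen (≺ a) ∘₂ gen (≻ b) +ᴹ -ᴹ gen (≺ a) ∘₂ gen (≺ a))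
      rel₃ : ∀ {a b} → a Fin.< b → DendrRelator
        (gen (≻ a) ∘₁ gen (≻ a) +ᴹ gen (≻ a) ∘₁ gen (≺ b) +ᴹ -ᴹ gen (≻ a) ∘₂ gen (≻ b))
      rel₄ : ∀ {a b} → a Fin.< b → DendrRelator
        (gen (≺ b) ∘₁ gen (≺ a) +ᴹ -ᴹ gen (≺ a) ∘₂ gen (≺ b) +ᴹ -ᴹ gen (≺ a) ∘₂ gen (≻ a))
      rel₅ : ∀ {a b} → a Fin.< b → DendrRelator
        (gen (≻ a) ∘₁ gen (≺ a) +ᴹ gen (≻ a) ∘₁ gen (≻ b) +ᴹ -ᴹ gen (≻ b) ∘₂ gen (≻ a))
      rel₆ : ∀ a → DendrRelator
        (gen (≺ a) ∘₁ gen (≺ a) +ᴹ -ᴹ gen (≺ a) ∘₂ gen (≻ a) +ᴹ -ᴹ gen (≺ a) ∘₂ gen (≺ a))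
      rel₇ : ∀ a → DendrRelator
        (gen (≻ a) ∘₁ gen (≻ a) +ᴹ gen (≻ a) ∘₁ gen (≺ a) +ᴹ -ᴹ gen (≻ a) ∘₂ gen (≻ a))

    DendrRelations : Pred (Op 3) (c ⊔ ℓ)
    DendrRelations = Span (space 3) DendrRelator

{-# OPTIONS --safe #-}
module Submission where

-- Let φ send ≺_b to ∑_{a ≤ b} ↼_a and ≻_b to ∑_{a ≤ b} ⇀_a.  Taking
-- differences of consecutive generators inverts φ on generators, and both
-- maps extend to mutually inverse morphisms φ, ψ of free operads.  It remains
-- to see that, in arity 3, φ maps the relations of Dendr into the annihilator
-- and ψ maps the annihilator into the span of the relations.
--
-- Each relator r of Dias is, up to sign, n − e, where the "normal" monomial e
-- determines r, and n is one of the other, "leading" monomials.  The relations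
-- of Dendr likewise rewrite each leading monomial u as a sum u′ of normal ones:
-- ≺_a ∘₁ ≻_b becomes ≻_b ∘₂ ≺_a, the last six families say uniformly
--   ≺_a ∘₁ ≺_b = ≺_m ∘₂ ≻_b + ≺_m ∘₂ ≺_a   with m = min(a, b),
-- together with the mirror image of this identity.
-- Pairing φ(u) and φ(u′) with r gives the same value, because
--   [i ≤ a][max(i, j) ≤ b] = [i ≤ m][j ≤ b],
-- so φ(u − u′) lies in the annihilator.  Conversely, reduce f = ∑ ⟨r, f⟩ e
-- vanishes on the annihilator, fixes φ(u′) when u′ is normal, and agrees on
-- φ(u) and φ(u′); hence ψ ∘ reduce ∘ φ is the identity modulo the relations,
-- and ψ f ∼ ψ (reduce f) = 0 for every f in the annihilator.

open import Level using (Level; _⊔_)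
open import Algebra.Apartness.Bundles using (HeytingField)
open import Algebra.Bundles using (CommutativeMonoid; CommutativeRing)
import Algebra.Construct.NaturalChoice.Max as Max
open import Algebra.Module.Bundles using (Module)
import Algebra.Module.Construct.TensorUnit as TensorUnit
import Algebra.Properties.AbelianGroup as AbelianGroupProperties
import Algebra.Properties.CommutativeMonoid.Sum as CommutativeMonoidSum
import Algebra.Properties.CommutativeSemigroup as CommutativeSemigroupProperties
import Algebra.Properties.Ring as RingProperties
open import Data.Bool.Base using (true; false; if_then_else_; _∧_)
open import Data.Fin.Base as Fin using (Fin; zero; suc; toℕ; inject≤; inject₁)
import Data.Fin.Properties as Fin
open import Data.Maybe.Base using (Maybe; just; nothing)
open import Data.Maybe.Properties using (just-injective)
open import Data.Nat.Base as ℕ using (ℕ; zero; suc)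
import Data.Nat.Properties as ℕ
open import Data.Product.Base using (Σ-syntax; ∃-syntax; _×_; _,_; proj₂; uncurry)
open import Data.Sum.Base using (_⊎_; inj₁; inj₂)
open import Function.Base using (_∘_)
open import Relation.Binary.Definitions using (DecidableEquality; tri<; tri≈; tri>)
open import Relation.Binary.PropositionalEquality.Core as ≡ using (_≡_; _≢_)
import Relation.Binary.Reasoning.Setoid as SetoidReasoning
open import Relation.Nullary using (¬_; Dec; yes; no; does; contradiction; recompute)
open import Relation.Unary using (Pred; _∈_)
open import Defs

private
  variable
    c ℓ g m ℓm s t p q : Level

-- Arities of grafted trees

arity-graft : ∀ {G : Set g} (t u : Tree G) {i n} → i ℕ.< leaves t → .(leaves u ≡ n) →
              leaves t ℕ.+ n ≡ suc (leaves (graft t i u))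
arity-graft t u i<t e =
  ≡.sym (≡.trans (leaves-graft t u i<t) (≡.cong (leaves t ℕ.+_) (recompute (_ ℕ.≟ _) e)))

-- The arity equation for plugging `l` into input 0 of a root whose right input already carries `r`;
-- hence `suc (leaves r)` for the outer operation.
arity-node : ∀ {G : Set g} (l r : Tree G) {n} → .(leaves l ℕ.+ leaves r ≡ n) →
             suc (leaves r) ℕ.+ leaves l ≡ suc n
arity-node l r e = ≡.cong suc (≡.trans (ℕ.+-comm (leaves r) (leaves l)) (recompute (_ ℕ.≟ _) e))

-- Morphisms out of a free operad

module FreeOperad (K : CommutativeRing c ℓ) where
  open Operads K

  record FreeMorphism (G : Set g) (P : Operad m ℓm) : Set (c ⊔ ℓ ⊔ g ⊔ m ⊔ ℓm) where
    private
      module F = Operad (Free G)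
      module P = Operad P
    field
      ⟦_⟧      : ∀ {n} → F.Op n → P.Op n
      isLinear : ∀ {n} → IsLinear (P.space n) (⟦_⟧ {n})
      𝟙-homo   : ⟦ F.𝟙 ⟧ P.≈ᴹ P.𝟙
      ∘-homo   : ∀ {m n k} (x : F.Op m) (i : Fin m) (y : F.Op n) .(e : m ℕ.+ n ≡ suc k) →
                 ⟦ x F.∘[ i ] y ⟨ e ⟩ ⟧ P.≈ᴹ ⟦ x ⟧ P.∘[ i ] ⟦ y ⟧ ⟨ e ⟩

    module _ {n : ℕ} where
      open IsLinear (isLinear {n}) public

  module _ (P : Operad m ℓm) {X : Set g} where
    open Operad P

    isLinear-∘ˡ : ∀ {m} {L : Combination X → Op m} → IsLinear (space m) L →
                  ∀ {n k} (i : Fin m) (y : Op n) .(e : m ℕ.+ n ≡ suc k) →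
                  IsLinear (space k) (λ x → L x ∘[ i ] y ⟨ e ⟩)
    isLinear-∘ˡ lin i y e = record
      { cong    = λ x≋ → ∘-cong i e (L.cong x≋) ≈ᴹ-refl
      -- Zero is rewritten as `0#` times zero, so that homogeneity of composition gives preservation
      -- of zero.
      ; 0-homo  = ≈ᴹ-trans (∘-cong i e (≈ᴹ-trans L.0-homo (≈ᴹ-sym (*ₗ-zeroˡ _))) ≈ᴹ-refl)
                    (≈ᴹ-trans (∘-*ₗˡ _ 0ᴹ i y e) (*ₗ-zeroˡ _))
      ; +-homo  = λ x x′ → ≈ᴹ-trans (∘-cong i e (L.+-homo x x′) ≈ᴹ-refl) (∘-+ˡ _ _ i y e)
      ; *ₗ-homo = λ a x → ≈ᴹ-trans (∘-cong i e (L.*ₗ-homo a x) ≈ᴹ-refl) (∘-*ₗˡ a _ i y e)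
      }
      where module L = IsLinear lin

    isLinear-∘ʳ : ∀ {n} {L : Combination X → Op n} → IsLinear (space n) L →
                  ∀ {m k} (x : Op m) (i : Fin m) .(e : m ℕ.+ n ≡ suc k) →
                  IsLinear (space k) (λ y → x ∘[ i ] L y ⟨ e ⟩)
    isLinear-∘ʳ lin x i e = record
      { cong    = λ y≋ → ∘-cong i e ≈ᴹ-refl (L.cong y≋)
      ; 0-homo  = ≈ᴹ-trans (∘-cong i e ≈ᴹ-refl (≈ᴹ-trans L.0-homo (≈ᴹ-sym (*ₗ-zeroˡ _))))
                    (≈ᴹ-trans (∘-*ₗʳ _ x i 0ᴹ e) (*ₗ-zeroˡ _))
      ; +-homo  = λ y y′ → ≈ᴹ-trans (∘-cong i e ≈ᴹ-refl (L.+-homo y y′)) (∘-+ʳ x i _ _ e)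
      ; *ₗ-homo = λ a y → ≈ᴹ-trans (∘-cong i e ≈ᴹ-refl (L.*ₗ-homo a y)) (∘-*ₗʳ a x i _ e)
      }
      where module L = IsLinear lin

  id-isLinear : {X : Set g} → IsLinear (freeModule X) (λ x → x)
  id-isLinear = record
    { cong = λ e → e ; 0-homo = refl ; +-homo = λ _ _ → refl ; *ₗ-homo = λ _ _ → refl }

  module _ {G : Set g} (P : Operad m ℓm) where
    private
      module F = Operad (Free G)
    open Operad P

    private
      -- Matching on the arity instead of on the equation lets the equation stay irrelevant, as it
      -- is in `TreeOfArity`.
      identity : ∀ n → .(1 ≡ n) → Op n
      identity 1 _ = 𝟙

    -- The right subtree is plugged in first, so that the left one still enters
    -- at input 0 and no index has to be shifted.
    evaluate : (G → Op 2) → (t : Tree G) → ∀ {n} → .(leaves t ≡ n) → Op n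
    evaluate f leaf         {n} e = identity n e
    evaluate f (node x l r)     e =
      (f x ∘[ Fin.suc Fin.zero ] evaluate f r ≡.refl ⟨ ≡.refl ⟩) ∘[ Fin.zero ] evaluate f l ≡.refl
        ⟨ arity-node l r e ⟩

    module _ (f : G → Op 2) where

      -- Induction on `t`. A graft into the left subtree is the sequential axiom; a graft into the
      -- right subtree is the sequential axiom below the root, followed by the parallel axiom to
      -- pass the left subtree. The position occurs both as `i` and as the number `k`, so that
      -- recursive calls may build their own `Fin` index.
      evaluate-graft : ∀ t u k (i : Fin (leaves t)) → toℕ i ≡ k → ∀ {n o} .(q : leaves u ≡ n)
        .(e : leaves t ℕ.+ n ≡ suc o) .(p : leaves (graft t k u) ≡ o) →
        evaluate f (graft t k u) p ≈ᴹ evaluate f t ≡.refl ∘[ i ] evaluate f u q ⟨ e ⟩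
      evaluate-graft leaf u _ Fin.zero _ {n} {o} q e p
        with recompute (leaves u ℕ.≟ n) q | recompute (leaves u ℕ.≟ o) p
      ... | ≡.refl | ≡.refl = ≈ᴹ-sym (∘-identityˡ (evaluate f u ≡.refl))
      evaluate-graft (node x l r) u _ i ≡.refl {n} q e p with side {G = G} (leaves l) (Fin.toℕ<n i)
      -- `graft` is stuck on a comparison of numbers; abstracting it together with `graft-left`
      -- replaces it by a `node` also inside the type of the irrelevant proof `p`.
      ... | left i<l with graft (node x l r) (toℕ i) u | graft-left x l r u i<l
      ...   | _ | ≡.refl = ≈ᴹ-trans
        (∘-cong Fin.zero _ ≈ᴹ-refl
          (evaluate-graft l u (toℕ i) (Fin.fromℕ< i<l) (Fin.toℕ-fromℕ< i<l) q l+n ≡.refl))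
        (≈ᴹ-sym (∘-sequential _ _ _ Fin.zero (Fin.fromℕ< i<l) i (≡.sym (Fin.toℕ-fromℕ< i<l)) _ e l+n _))
        where
        l+n : leaves l ℕ.+ n ≡ suc (leaves (graft l (toℕ i) u))
        l+n = arity-graft l u i<l q
      evaluate-graft (node x l r) u _ i ≡.refl {n} q e p | right j j<r l+j≡i
        with graft (node x l r) (toℕ i) u
           | ≡.trans (≡.cong (λ k → graft (node x l r) k u) (≡.sym l+j≡i)) (graft-right x l r u j)
      ...   | _ | ≡.refl = ≈ᴹ-trans
        (∘-cong Fin.zero _ (≈ᴹ-trans
          (∘-cong (Fin.suc Fin.zero) _ ≈ᴹ-refl (evaluate-graft r u j j′ (Fin.toℕ-fromℕ< j<r) q r+n ≡.refl))
          (≈ᴹ-sym (∘-sequential _ _ _ (Fin.suc Fin.zero) j′ (Fin.suc j′) ≡.refl _ (≡.cong suc r+n) r+n _)))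
          ≈ᴹ-refl)
        -- While the left input is free, input `j` of `r` is input `suc j′` of the composite;
        -- plugging in `l` moves it to `leaves l + j`, which is `i`.
        (≈ᴹ-sym (∘-parallel _ _ _ Fin.zero (Fin.suc j′) i Fin.zero ℕ.z<s
          (≡.cong suc (≡.trans (≡.sym l+j≡i) (≡.trans (ℕ.+-comm (leaves l) j)
            (≡.cong (ℕ._+ leaves l) (≡.sym (Fin.toℕ-fromℕ< j<r))))))
          ≡.refl _ e (≡.cong suc r+n) _))
        where
        j′ = Fin.fromℕ< j<r
        r+n : leaves r ℕ.+ n ≡ suc (leaves (graft r j u))
        r+n = arity-graft r u j<r q

      private
        value : ∀ {n} → TreeOfArity G n → Op n
        value (t , p) = evaluate f t p

        value-substitute : ∀ {m n k} (t : TreeOfArity G m) (i : Fin m) (u : TreeOfArity G n)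
          .(e : m ℕ.+ n ≡ suc k) → value (substitute t i u e) ≈ᴹ value t ∘[ i ] value u ⟨ e ⟩
        value-substitute {m} (t , p) i (u , q) e with recompute (leaves t ℕ.≟ m) p
        ... | ≡.refl = evaluate-graft t u (toℕ i) i ≡.refl q e _

      lift : FreeMorphism G P
      lift = record
        { ⟦_⟧      = ⟦_⟧
        ; isLinear = isLinear
        ; 𝟙-homo   = ≈ᴹ-refl
        ; ∘-homo   = λ x i y e → linear-unique (space _)
            (∘-isLinear (space _) isLinear (F-isLinearˡ i y e))
            (isLinear-∘ˡ P isLinear i ⟦ y ⟧ e)
            (λ t → linear-unique (space _)
              (∘-isLinear (space _) isLinear (F-isLinearʳ [ t ] i e))
              (isLinear-∘ʳ P isLinear (value t) i e)
              (λ u → value-substitute t i u e) y) x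
        }
        where
        ⟦_⟧ : ∀ {n} → F.Op n → Op n
        ⟦_⟧ {n} = extend (space n) value
        isLinear : ∀ {n} → IsLinear (space n) ⟦_⟧
        isLinear {n} = extend-isLinear (space n) value
        F-isLinearˡ : ∀ {m n k} (i : Fin m) (y : F.Op n) .(e : m ℕ.+ n ≡ suc k) →
                      IsLinear (F.space k) (λ x → x F.∘[ i ] y ⟨ e ⟩)
        F-isLinearˡ = isLinear-∘ˡ (Free G) id-isLinear
        F-isLinearʳ : ∀ {m n k} (x : F.Op m) (i : Fin m) .(e : m ℕ.+ n ≡ suc k) →
                      IsLinear (F.space k) (λ (y : F.Op n) → x F.∘[ i ] y ⟨ e ⟩)
        F-isLinearʳ = isLinear-∘ʳ (Free G) id-isLinear

      lift-gen : ∀ x → FreeMorphism.⟦_⟧ lift (gen x) ≈ᴹ f x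
      lift-gen x = ≈ᴹ-trans (∘-identityʳ _ Fin.zero _) (∘-identityʳ (f x) (Fin.suc Fin.zero) _)

    -- Every tree is built from generators: composing `gen x` with `r` and then `l` computes to
    -- `node x l r`, so agreement on generators spreads by induction on trees, then by linearity.
    morphism-unique : (φ ψ : FreeMorphism G P) →
      (∀ x → FreeMorphism.⟦_⟧ φ (gen x) ≈ᴹ FreeMorphism.⟦_⟧ ψ (gen x)) →
      ∀ {n} x → FreeMorphism.⟦_⟧ φ {n} x ≈ᴹ FreeMorphism.⟦_⟧ ψ x
    morphism-unique φ ψ agree {n} =
      linear-unique (space n) φ.isLinear ψ.isLinear (λ { (t , p) → trees t p })
      where
      module φ = FreeMorphism φ
      module ψ = FreeMorphism ψ
      trees : ∀ t {n} .(p : leaves t ≡ n) → φ.⟦ [ t , p ] ⟧ ≈ᴹ ψ.⟦ [ t , p ] ⟧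
      trees leaf {1} p = ≈ᴹ-trans φ.𝟙-homo (≈ᴹ-sym ψ.𝟙-homo)
      trees (node x l r) p = ≈ᴹ-trans (split φ)
        (≈ᴹ-trans (∘-cong Fin.zero e (∘-cong (Fin.suc Fin.zero) ≡.refl (agree x) (trees r ≡.refl)) (trees l ≡.refl))
        (≈ᴹ-sym (split ψ)))
        where
        e = arity-node l r p
        split : (χ : FreeMorphism G P) → FreeMorphism.⟦_⟧ χ [ node x l r , p ] ≈ᴹ
          (FreeMorphism.⟦_⟧ χ (gen x) ∘[ Fin.suc Fin.zero ] FreeMorphism.⟦_⟧ χ [ r , ≡.refl ] ⟨ ≡.refl ⟩)
            ∘[ Fin.zero ] FreeMorphism.⟦_⟧ χ [ l , ≡.refl ] ⟨ e ⟩
        split χ = ≈ᴹ-trans (FreeMorphism.∘-homo χ _ Fin.zero _ e)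
          (∘-cong Fin.zero e (FreeMorphism.∘-homo χ _ (Fin.suc Fin.zero) _ _) ≈ᴹ-refl)

  identity-morphism : {G : Set g} → FreeMorphism G (Free G)
  identity-morphism = record
    { ⟦_⟧      = λ x → x
    ; isLinear = id-isLinear
    ; 𝟙-homo   = refl
    ; ∘-homo   = λ _ _ _ _ → refl
    }

  compose : {G H : Set g} {P : Operad m ℓm} →
            FreeMorphism H P → FreeMorphism G (Free H) → FreeMorphism G P
  compose {P = P} ψ φ = record
    { ⟦_⟧      = ψ.⟦_⟧ ∘ φ.⟦_⟧
    ; isLinear = ∘-isLinear (space _) ψ.isLinear φ.isLinear
    ; 𝟙-homo   = ≈ᴹ-trans (ψ.cong φ.𝟙-homo) ψ.𝟙-homo
    ; ∘-homo   = λ x i y e → ≈ᴹ-trans (ψ.cong (φ.∘-homo x i y e)) (ψ.∘-homo _ i _ e)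
    }
    where
    open Operad P
    module φ = FreeMorphism φ
    module ψ = FreeMorphism ψ

  module _ {G H : Set g} (φ : FreeMorphism G (Free H)) (ψ : FreeMorphism H (Free G)) where
    private
      module φ = FreeMorphism φ
      module ψ = FreeMorphism ψ

    leftInverse : (∀ x → ψ.⟦ φ.⟦ gen x ⟧ ⟧ ≋ gen x) → ∀ {n} x → ψ.⟦ φ.⟦_⟧ {n} x ⟧ ≋ x
    leftInverse = morphism-unique (Free G) (compose ψ φ) identity-morphism

  module _ {G H : Set g} (φ : FreeMorphism G (Free H)) where
    open FreeMorphism φ

    ideal-homo : ∀ {k} {R : Pred (Operad.Op (Free G) k) s} {S : Pred (Operad.Op (Free H) k) t} →
                 (∀ {x} → x ∈ R → ⟦ x ⟧ ∈ Ideal (Free H) S) →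
                 ∀ {n} {x : Operad.Op (Free G) n} → x ∈ Ideal (Free G) R → ⟦ x ⟧ ∈ Ideal (Free H) S
    ideal-homo R⊆S (generator r)   = R⊆S r
    ideal-homo R⊆S zero            = resp (sym 0-homo) zero
    ideal-homo R⊆S (plus p q)      = resp (sym (+-homo _ _)) (plus (ideal-homo R⊆S p) (ideal-homo R⊆S q))
    ideal-homo R⊆S (scale a p)     = resp (sym (*ₗ-homo a _)) (scale a (ideal-homo R⊆S p))
    ideal-homo R⊆S (resp x≈y p)    = resp (cong x≈y) (ideal-homo R⊆S p)
    ideal-homo R⊆S (compˡ i y e p) = resp (sym (∘-homo _ i y e)) (compˡ i ⟦ y ⟧ e (ideal-homo R⊆S p))
    ideal-homo R⊆S (compʳ x i e p) = resp (sym (∘-homo x i _ e)) (compʳ ⟦ x ⟧ i e (ideal-homo R⊆S p))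

    ∼-homo : ∀ {k} {R : Pred (Operad.Op (Free G) k) s} {S : Pred (Operad.Op (Free H) k) t} →
             (∀ {x} → x ∈ R → ⟦ x ⟧ ∈ Ideal (Free H) S) →
             ∀ {n} {x y : Operad.Op (Free G) n} → _∼_ (Free G) R x y → _∼_ (Free H) S ⟦ x ⟧ ⟦ y ⟧
    ∼-homo R⊆S x∼y =
      -- Negation in a free module is `(- 1#) ⊙_`, so `*ₗ-homo` takes care of it.
      resp (trans (+-homo _ _) (⊕-cong refl (*ₗ-homo _ _))) (ideal-homo R⊆S x∼y)

  module _ {G H : Set g} (φ : FreeMorphism G (Free H)) (ψ : FreeMorphism H (Free G))
           {k} {R : Pred (Operad.Op (Free G) k) s} {S : Pred (Operad.Op (Free H) k) t} where
    private
      module φ = FreeMorphism φ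
      module ψ = FreeMorphism ψ
      module P = Operad (Free G /⟨ R ⟩)
      module Q = Operad (Free H /⟨ S ⟩)

    -- A quotient keeps the carriers of the free operad, so `φ` itself serves as the map. Being
    -- inverse on generators makes `φ` and `ψ` inverse everywhere; injectivity follows by applying
    -- `ψ`, and preimages are given by `ψ`.
    quotient-isomorphism :
      (∀ x → ψ.⟦ φ.⟦ gen x ⟧ ⟧ ≋ gen x) → (∀ y → φ.⟦ ψ.⟦ gen y ⟧ ⟧ ≋ gen y) →
      (∀ {x} → x ∈ R → φ.⟦ x ⟧ ∈ Ideal (Free H) S) → (∀ {y} → y ∈ S → ψ.⟦ y ⟧ ∈ Ideal (Free G) R) →
      OperadIsomorphism (Free G /⟨ R ⟩) (Free H /⟨ S ⟩)
    quotient-isomorphism ψφ φψ R⊆S S⊆R = record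
      { ⟦_⟧ = φ.⟦_⟧
      ; isModuleIsomorphism = record
        { isModuleMonomorphism = record
          { isModuleHomomorphism = record
            { isBimoduleHomomorphism = record
              { +ᴹ-isGroupHomomorphism = record
                { isMonoidHomomorphism = record
                  { isMagmaHomomorphism = record
                    { isRelHomomorphism = record { cong = ∼-homo φ R⊆S }
                    ; homo = λ x y → ≈⇒H (φ.+-homo x y)
                    }
                  ; ε-homo = ≈⇒H φ.0-homo
                  }
                ; ⁻¹-homo = λ x → ≈⇒H (φ.*ₗ-homo _ x)
                }
              ; *ₗ-homo = λ a x → ≈⇒H (φ.*ₗ-homo a x)
              ; *ᵣ-homo = λ a x → ≈⇒H (φ.*ₗ-homo a x)
              }
            }
          ; injective = λ {x} {y} φx∼φy → P.≈ᴹ-trans (P.≈ᴹ-sym (≈⇒G (leftInverse φ ψ ψφ x)))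
              (P.≈ᴹ-trans (∼-homo ψ S⊆R φx∼φy) (≈⇒G (leftInverse φ ψ ψφ y)))
          }
        ; surjective = λ y → ψ.⟦ y ⟧ , λ z∼ψy →
            Q.≈ᴹ-trans (∼-homo φ R⊆S z∼ψy) (≈⇒H (leftInverse ψ φ φψ y))
        }
      ; 𝟙-homo = ≈⇒H φ.𝟙-homo
      ; ∘-homo = λ x i y e → ≈⇒H (φ.∘-homo x i y e)
      }
      where
      ≈⇒G : ∀ {n} {x y : Operad.Op (Free G) n} → x ≋ y → x P.≈ᴹ y
      ≈⇒G = ≈⇒∼ (Free G) R
      ≈⇒H : ∀ {n} {x y : Operad.Op (Free H) n} → x ≋ y → x Q.≈ᴹ y
      ≈⇒H = ≈⇒∼ (Free H) S

-- Finite sums and linear maps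

module LinearAlgebra (K : CommutativeRing c ℓ) where
  open Operads K
  private module K = CommutativeRing K
  open K using (_≈_; _+_; _*_; 0#; 1#; -_) renaming (Carrier to Scalar)

  scalars : Module K c ℓ
  scalars = TensorUnit.⟨module⟩

  module Sums (M : Module K m ℓm) where
    open Module M
    open CommutativeMonoidSum +ᴹ-commutativeMonoid public
      using (sum; sum-cong-≋; sum-replicate-zero; ∑-distrib-+)
    open SetoidReasoning ≈ᴹ-setoid

    sum-zero : ∀ {n} {f : Fin n → Carrierᴹ} → (∀ i → f i ≈ᴹ 0ᴹ) → sum f ≈ᴹ 0ᴹ
    sum-zero {n} f≈0 = ≈ᴹ-trans (sum-cong-≋ f≈0) (sum-replicate-zero n)

    sum-single : ∀ {n} {f : Fin n → Carrierᴹ} i → (∀ j → j ≢ i → f j ≈ᴹ 0ᴹ) → sum f ≈ᴹ f i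
    sum-single zero    f≈0 = ≈ᴹ-trans
      (+ᴹ-cong ≈ᴹ-refl (sum-zero (λ j → f≈0 (suc j) λ ()))) (+ᴹ-identityʳ _)
    sum-single (suc i) f≈0 = ≈ᴹ-trans
      (+ᴹ-cong (f≈0 zero λ ()) (sum-single i (λ j j≢i → f≈0 (suc j) (j≢i ∘ Fin.suc-injective))))
      (+ᴹ-identityˡ _)

    *ₗ-distribˡ-sum : ∀ {n} a (f : Fin n → Carrierᴹ) → a *ₗ sum f ≈ᴹ sum (λ i → a *ₗ f i)
    *ₗ-distribˡ-sum {zero}  a f = *ₗ-zeroʳ a
    *ₗ-distribˡ-sum {suc n} a f =
      ≈ᴹ-trans (*ₗ-distribˡ a _ _) (+ᴹ-cong ≈ᴹ-refl (*ₗ-distribˡ-sum a (f ∘ suc)))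

    partialSum : ∀ {n} → (Fin n → Carrierᴹ) → Fin n → Carrierᴹ
    partialSum f b = sum {n = suc (toℕ b)} (λ a → f (inject≤ a (Fin.toℕ<n b)))

    -- Möbius inversion on the chain `Fin n`: it undoes `partialSum` on both sides.
    difference : ∀ {n} → (Fin n → Carrierᴹ) → Fin n → Carrierᴹ
    difference f zero    = f zero
    difference f (suc b) = f (suc b) +ᴹ -ᴹ f (inject₁ b)

    difference-cong : ∀ {n} {f f′ : Fin n → Carrierᴹ} → (∀ a → f a ≈ᴹ f′ a) →
                      ∀ b → difference f b ≈ᴹ difference f′ b
    difference-cong f≈f′ zero    = f≈f′ zero
    difference-cong f≈f′ (suc b) = +ᴹ-cong (f≈f′ (suc b)) (-ᴹ‿cong (f≈f′ (inject₁ b)))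

    private
      telescope : ∀ {n} (f : Fin (suc n) → Carrierᴹ) b →
        partialSum (λ a → f (suc a) +ᴹ -ᴹ f (inject₁ a)) b ≈ᴹ f (suc b) +ᴹ -ᴹ f zero
      telescope f zero    = +ᴹ-identityʳ _
      telescope f (suc b) = begin
        (f (suc zero) +ᴹ -ᴹ f zero) +ᴹ partialSum (λ a → f (suc (suc a)) +ᴹ -ᴹ f (suc (inject₁ a))) b
          ≈⟨ +ᴹ-cong ≈ᴹ-refl (telescope (f ∘ suc) b) ⟩
        (f (suc zero) +ᴹ -ᴹ f zero) +ᴹ (f (suc (suc b)) +ᴹ -ᴹ f (suc zero))
          ≈⟨ +ᴹ-comm _ _ ⟩
        (f (suc (suc b)) +ᴹ -ᴹ f (suc zero)) +ᴹ (f (suc zero) +ᴹ -ᴹ f zero)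
          ≈⟨ cancel _ _ _ ⟩
        f (suc (suc b)) +ᴹ -ᴹ f zero ∎
        where
        cancel : ∀ x y z → (x +ᴹ -ᴹ y) +ᴹ (y +ᴹ z) ≈ᴹ x +ᴹ z
        cancel x y z = begin
          (x +ᴹ -ᴹ y) +ᴹ (y +ᴹ z)  ≈⟨ +ᴹ-assoc _ _ _ ⟩
          x +ᴹ (-ᴹ y +ᴹ (y +ᴹ z))  ≈⟨ +ᴹ-cong ≈ᴹ-refl (+ᴹ-assoc _ _ _) ⟨
          x +ᴹ ((-ᴹ y +ᴹ y) +ᴹ z)  ≈⟨ +ᴹ-cong ≈ᴹ-refl (+ᴹ-cong (-ᴹ‿inverseˡ y) ≈ᴹ-refl) ⟩
          x +ᴹ (0ᴹ +ᴹ z)           ≈⟨ +ᴹ-cong ≈ᴹ-refl (+ᴹ-identityˡ z) ⟩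
          x +ᴹ z                   ∎

    partialSum-difference : ∀ {n} (f : Fin n → Carrierᴹ) b → partialSum (difference f) b ≈ᴹ f b
    partialSum-difference f zero    = +ᴹ-identityʳ _
    partialSum-difference f (suc b) = begin
      f zero +ᴹ partialSum (λ a → f (suc a) +ᴹ -ᴹ f (inject₁ a)) b ≈⟨ +ᴹ-cong ≈ᴹ-refl (telescope f b) ⟩
      f zero +ᴹ (f (suc b) +ᴹ -ᴹ f zero)                           ≈⟨ xyx⁻¹≈y _ _ ⟩
      f (suc b)                                                    ∎
      where
      xyx⁻¹≈y : ∀ x y → x +ᴹ (y +ᴹ -ᴹ x) ≈ᴹ y
      xyx⁻¹≈y x y = ≈ᴹ-trans (≈ᴹ-sym (+ᴹ-assoc _ _ _))
        (AbelianGroupProperties.xyx⁻¹≈y +ᴹ-abelianGroup x y)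

    private
      -- `partialSum` unfolds at its first summand, whereas cancelling two consecutive partial sums
      -- needs the last one split off.
      partialSum-step : ∀ {n} (f : Fin (suc n) → Carrierᴹ) b →
        partialSum f (suc b) ≈ᴹ f (suc b) +ᴹ partialSum f (inject₁ b)
      partialSum-step f zero    = ≈ᴹ-trans (≈ᴹ-sym (+ᴹ-assoc _ _ _))
        (≈ᴹ-trans (+ᴹ-cong (+ᴹ-comm _ _) ≈ᴹ-refl) (+ᴹ-assoc _ _ _))
      partialSum-step f (suc b) = begin
        f zero +ᴹ partialSum (f ∘ suc) (suc b)                            ≈⟨ +ᴹ-cong ≈ᴹ-refl (partialSum-step (f ∘ suc) b) ⟩
        f zero +ᴹ (f (suc (suc b)) +ᴹ partialSum (f ∘ suc) (inject₁ b))   ≈⟨ +ᴹ-assoc _ _ _ ⟨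
        (f zero +ᴹ f (suc (suc b))) +ᴹ partialSum (f ∘ suc) (inject₁ b)   ≈⟨ +ᴹ-cong (+ᴹ-comm _ _) ≈ᴹ-refl ⟩
        (f (suc (suc b)) +ᴹ f zero) +ᴹ partialSum (f ∘ suc) (inject₁ b)   ≈⟨ +ᴹ-assoc _ _ _ ⟩
        f (suc (suc b)) +ᴹ (f zero +ᴹ partialSum (f ∘ suc) (inject₁ b))   ∎

    difference-partialSum : ∀ {n} (f : Fin n → Carrierᴹ) b → difference (partialSum f) b ≈ᴹ f b
    difference-partialSum f zero    = +ᴹ-identityʳ _
    difference-partialSum f (suc b) = begin
      partialSum f (suc b) +ᴹ -ᴹ partialSum f (inject₁ b)                      ≈⟨ +ᴹ-cong (partialSum-step f b) ≈ᴹ-refl ⟩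
      (f (suc b) +ᴹ partialSum f (inject₁ b)) +ᴹ -ᴹ partialSum f (inject₁ b)   ≈⟨ +ᴹ-assoc _ _ _ ⟩
      f (suc b) +ᴹ (partialSum f (inject₁ b) +ᴹ -ᴹ partialSum f (inject₁ b))   ≈⟨ +ᴹ-cong ≈ᴹ-refl (-ᴹ‿inverseʳ _) ⟩
      f (suc b) +ᴹ 0ᴹ                                                          ≈⟨ +ᴹ-identityʳ _ ⟩
      f (suc b)                                                                ∎

  indicator : {P : Set p} → Dec P → Scalar
  indicator P? = if does P? then 1# else 0#

  module _ {P : Set p} {Q : Set q} where
    indicator-⇔ : (P? : Dec P) (Q? : Dec Q) → (P → Q) → (Q → P) → indicator P? ≈ indicator Q?
    indicator-⇔ (yes _) (yes _) _ _ = K.refl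
    indicator-⇔ (yes p) (no ¬q) f _ = contradiction (f p) ¬q
    indicator-⇔ (no ¬p) (yes q) _ g = contradiction (g q) ¬p
    indicator-⇔ (no _)  (no _)  _ _ = K.refl

    indicator-* : (P? : Dec P) (Q? : Dec Q) → (P → Q) → indicator P? * indicator Q? ≈ indicator P?
    indicator-* (yes p) (yes _) _ = K.*-identityˡ _
    indicator-* (yes p) (no ¬q) f = contradiction (f p) ¬q
    indicator-* (no _)  _       _ = K.zeroˡ _

  -- `treePairing` tests both generators at once; this gives one factor per generator.
  if-∧ : ∀ b b′ (x : Scalar) →
         (if b ∧ b′ then x else 0#) ≈ x * ((if b then 1# else 0#) * (if b′ then 1# else 0#))
  if-∧ true  true  x = K.sym (K.trans (K.*-congˡ (K.*-identityˡ _)) (K.*-identityʳ x))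
  if-∧ true  false x = K.sym (K.trans (K.*-congˡ (K.zeroʳ _)) (K.zeroʳ x))
  if-∧ false _     x = K.sym (K.trans (K.*-congˡ (K.zeroˡ _)) (K.zeroʳ x))

  module _ (M : Module K m ℓm) where
    open Module M
    open Sums M

    indicator-yes : {P : Set p} (P? : Dec P) → P → ∀ x → indicator P? *ₗ x ≈ᴹ x
    indicator-yes (yes _) _ x = *ₗ-identityˡ x
    indicator-yes (no ¬p) p x = contradiction p ¬p

    indicator-no : {P : Set p} (P? : Dec P) → ¬ P → ∀ x → indicator P? *ₗ x ≈ᴹ 0ᴹ
    indicator-no (yes p) ¬p x = contradiction p ¬p
    indicator-no (no _)  _  x = *ₗ-zeroˡ x

    -- The range of the sum no longer depends on `b`, so single terms can be isolated and
    -- coefficients compared index by index.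
    partialSum-indicator : ∀ {n} (f : Fin n → Carrierᴹ) b →
      partialSum f b ≈ᴹ sum (λ a → indicator (a Fin.≤? b) *ₗ f a)
    partialSum-indicator {suc n} f zero    =
      +ᴹ-cong (≈ᴹ-sym (*ₗ-identityˡ _)) (≈ᴹ-sym (sum-zero {n} (λ a → *ₗ-zeroˡ (f (suc a)))))
    partialSum-indicator {suc n} f (suc b) =
      +ᴹ-cong (≈ᴹ-sym (*ₗ-identityˡ _))
        (≈ᴹ-trans (partialSum-indicator (f ∘ suc) b)
          (sum-cong-≋ {n} (λ a → *ₗ-cong (indicator-⇔ (a Fin.≤? b) (suc a Fin.≤? suc b) ℕ.s≤s ℕ.s≤s⁻¹) ≈ᴹ-refl)))

  module _ (M : Module K m ℓm) {X : Set g} where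
    open Module M
    private
      module F = Sums (freeModule X)
      module S = Sums M

    module _ {L : Combination X → Carrierᴹ} (lin : IsLinear M L) where
      open IsLinear lin

      sum-homo : ∀ {n} (f : Fin n → Combination X) → L (F.sum f) ≈ᴹ S.sum (L ∘ f)
      sum-homo {zero}  f = 0-homo
      sum-homo {suc n} f = ≈ᴹ-trans (+-homo _ _) (+ᴹ-cong ≈ᴹ-refl (sum-homo (f ∘ suc)))

      -‿homo : ∀ x → L ((- 1#) ⊙ x) ≈ᴹ -ᴹ L x
      -‿homo x = inverseʳ-unique _ _
        (≈ᴹ-trans (≈ᴹ-sym (+-homo _ _)) (≈ᴹ-trans (cong (Module.-ᴹ‿inverseʳ (freeModule X) x)) 0-homo))
        where open AbelianGroupProperties +ᴹ-abelianGroup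

      difference-homo : ∀ {n} (f : Fin n → Combination X) b → L (F.difference f b) ≈ᴹ S.difference (L ∘ f) b
      difference-homo f zero    = ≈ᴹ-refl
      difference-homo f (suc b) = ≈ᴹ-trans (+-homo _ _) (+ᴹ-cong ≈ᴹ-refl (-‿homo _))

    isLinear-sum : ∀ {n} {L : Fin n → Combination X → Carrierᴹ} → (∀ i → IsLinear M (L i)) →
                   IsLinear M (λ x → S.sum (λ i → L i x))
    isLinear-sum {n} {L} lin = record
      { cong    = λ x≋y → S.sum-cong-≋ {n} (λ i → L.cong i x≋y)
      ; 0-homo  = S.sum-zero {n} (λ i → L.0-homo i)
      ; +-homo  = λ x y → ≈ᴹ-trans (S.sum-cong-≋ {n} (λ i → L.+-homo i x y)) (S.∑-distrib-+ {n} (λ i → L i x) (λ i → L i y))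
      ; *ₗ-homo = λ a x → ≈ᴹ-trans (S.sum-cong-≋ {n} (λ i → L.*ₗ-homo i a x)) (≈ᴹ-sym (S.*ₗ-distribˡ-sum {n} a (λ i → L i x)))
      }
      where module L i = IsLinear (lin i)

    isLinear-*ₗ : {L : Combination X → Scalar} → IsLinear scalars L → ∀ y → IsLinear M (λ x → L x *ₗ y)
    isLinear-*ₗ lin y = record
      { cong    = λ x≋x′ → *ₗ-cong (L.cong x≋x′) ≈ᴹ-refl
      ; 0-homo  = ≈ᴹ-trans (*ₗ-cong L.0-homo ≈ᴹ-refl) (*ₗ-zeroˡ y)
      ; +-homo  = λ x x′ → ≈ᴹ-trans (*ₗ-cong (L.+-homo x x′) ≈ᴹ-refl) (*ₗ-distribʳ y _ _)
      ; *ₗ-homo = λ a x → ≈ᴹ-trans (*ₗ-cong (L.*ₗ-homo a x) ≈ᴹ-refl) (*ₗ-assoc a _ y)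
      }
      where module L = IsLinear lin

    isLinear-scale : {L : Combination X → Carrierᴹ} → IsLinear M L → ∀ a → IsLinear M (λ x → a *ₗ L x)
    isLinear-scale lin a = record
      { cong    = λ x≋y → *ₗ-cong K.refl (L.cong x≋y)
      ; 0-homo  = ≈ᴹ-trans (*ₗ-cong K.refl L.0-homo) (*ₗ-zeroʳ a)
      ; +-homo  = λ x y → ≈ᴹ-trans (*ₗ-cong K.refl (L.+-homo x y)) (*ₗ-distribˡ a _ _)
      ; *ₗ-homo = λ b x → ≈ᴹ-trans (*ₗ-cong K.refl (L.*ₗ-homo b x)) (*ₗ-comm a b _)
      }
      where module L = IsLinear lin

-- Quadratic monomials

-- ◂ stands for ⊣, ≺ and ∘₁, and ▸ for ⊢, ≻ and ∘₂: exchanging the two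
-- directions is a symmetry of the relations of Dias and of Dendr.
data Dir : Set where
  ◂ ▸ : Dir

opposite : Dir → Dir
opposite ◂ = ▸
opposite ▸ = ◂

_≟ᵈ_ : DecidableEquality Dir
◂ ≟ᵈ ◂ = yes ≡.refl
◂ ≟ᵈ ▸ = no λ ()
▸ ≟ᵈ ◂ = no λ ()
▸ ≟ᵈ ▸ = yes ≡.refl

-- The monomial x ∘ᵢ y has the shape ⟪ i , direction of x , direction of y ⟫.
record Shape : Set where
  constructor ⟪_,_,_⟫
  field
    position root child : Dir

-- The five families of relators of Dias, in the order of the paper:
-- swap, inner ◂, inner ▸, outer ◂, outer ▸.
data Kind : Set where
  swap        : Kind
  inner outer : Dir → Kind

-- `inner s` and `outer s` share a leading shape, which is why a monomial of shape `⟪ s , s , s ⟫`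
-- expands into two normal ones. `normal` is injective.
leading normal : Kind → Shape
leading swap      = ⟪ ◂ , ◂ , ▸ ⟫
leading (inner s) = ⟪ s , s , s ⟫
leading (outer s) = ⟪ s , s , s ⟫
normal swap      = ⟪ ▸ , ▸ , ◂ ⟫
normal (inner s) = ⟪ opposite s , s , opposite s ⟫
normal (outer s) = ⟪ opposite s , s , s ⟫

-- A partial inverse of `normal`, undefined exactly on the leading shapes; it yields injectivity and
-- disjointness without comparing kinds pairwise.
normalKind : Shape → Maybe Kind
normalKind ⟪ ◂ , ▸ , ◂ ⟫ = just (inner ▸)
normalKind ⟪ ◂ , ▸ , ▸ ⟫ = just (outer ▸)
normalKind ⟪ ▸ , ◂ , ◂ ⟫ = just (outer ◂)
normalKind ⟪ ▸ , ◂ , ▸ ⟫ = just (inner ◂)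
normalKind ⟪ ▸ , ▸ , ◂ ⟫ = just swap
normalKind _             = nothing

normalKind-normal : ∀ k → normalKind (normal k) ≡ just k
normalKind-normal swap      = ≡.refl
normalKind-normal (inner ◂) = ≡.refl
normalKind-normal (inner ▸) = ≡.refl
normalKind-normal (outer ◂) = ≡.refl
normalKind-normal (outer ▸) = ≡.refl

normalKind-leading : ∀ k → normalKind (leading k) ≡ nothing
normalKind-leading swap      = ≡.refl
normalKind-leading (inner ◂) = ≡.refl
normalKind-leading (inner ▸) = ≡.refl
normalKind-leading (outer ◂) = ≡.refl
normalKind-leading (outer ▸) = ≡.refl

normal-injective : ∀ {k l} → normal k ≡ normal l → k ≡ l
normal-injective {k} {l} e =
  just-injective (≡.trans (≡.sym (normalKind-normal k)) (≡.trans (≡.cong normalKind e) (normalKind-normal l)))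

leading≢normal : ∀ k l → leading k ≢ normal l
leading≢normal k l e
  with ≡.trans (≡.sym (normalKind-leading k)) (≡.trans (≡.cong normalKind e) (normalKind-normal l))
... | ()

data Classified : Shape → Set where
  isNormal  : ∀ k → Classified (normal k)
  isLeading : ∀ k → Classified (leading k)

classify : ∀ σ → Classified σ
classify ⟪ ◂ , ◂ , ◂ ⟫ = isLeading (inner ◂)
classify ⟪ ◂ , ◂ , ▸ ⟫ = isLeading swap
classify ⟪ ◂ , ▸ , ◂ ⟫ = isNormal (inner ▸)
classify ⟪ ◂ , ▸ , ▸ ⟫ = isNormal (outer ▸)
classify ⟪ ▸ , ◂ , ◂ ⟫ = isNormal (outer ◂)
classify ⟪ ▸ , ◂ , ▸ ⟫ = isNormal (inner ◂)
classify ⟪ ▸ , ▸ , ◂ ⟫ = isNormal swap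
classify ⟪ ▸ , ▸ , ▸ ⟫ = isLeading (inner ▸)

-- The enumeration lets `reduce` be a finite `sum` over kinds from which one term can be isolated.
toKind : Fin 5 → Kind
toKind zero                         = swap
toKind (suc zero)                   = inner ◂
toKind (suc (suc zero))             = inner ▸
toKind (suc (suc (suc zero)))       = outer ◂
toKind (suc (suc (suc (suc zero)))) = outer ▸

fromKind : Kind → Fin 5
fromKind swap      = zero
fromKind (inner ◂) = suc zero
fromKind (inner ▸) = suc (suc zero)
fromKind (outer ◂) = suc (suc (suc zero))
fromKind (outer ▸) = suc (suc (suc (suc zero)))

fromKind-toKind : ∀ i → fromKind (toKind i) ≡ i
fromKind-toKind zero                         = ≡.refl
fromKind-toKind (suc zero)                   = ≡.refl
fromKind-toKind (suc (suc zero))             = ≡.refl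
fromKind-toKind (suc (suc (suc zero)))       = ≡.refl
fromKind-toKind (suc (suc (suc (suc zero)))) = ≡.refl

toKind-fromKind : ∀ k → toKind (fromKind k) ≡ k
toKind-fromKind swap      = ≡.refl
toKind-fromKind (inner ◂) = ≡.refl
toKind-fromKind (inner ▸) = ≡.refl
toKind-fromKind (outer ◂) = ≡.refl
toKind-fromKind (outer ▸) = ≡.refl

-- Trees with two or three leaves

corolla : {G : Set g} → G → Tree G
corolla x = node x leaf leaf

leaves>0 : {G : Set g} (t : Tree G) → leaves t ℕ.> 0
leaves>0 leaf         = ℕ.z<s
leaves>0 (node _ l r) = ℕ.≤-trans (leaves>0 l) (ℕ.m≤m+n _ _)

1-leaf : {G : Set g} {t : Tree G} → leaves t ℕ.≤ 1 → t ≡ leaf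
1-leaf {t = leaf}       _ = ≡.refl
1-leaf {t = node _ l r} p with ℕ.≤-trans (ℕ.+-mono-≤ (leaves>0 l) (leaves>0 r)) p
... | ℕ.s≤s ()

2-leaves : {G : Set g} (t : Tree G) → leaves t ≡ 2 → ∃[ x ] t ≡ corolla x
2-leaves (node x l r) e
  with 1-leaf {t = l} (ℕ.s≤s⁻¹ (≡.subst (leaves l ℕ.<_) e (ℕ.m<m+n _ (leaves>0 r))))
     | 1-leaf {t = r} (ℕ.s≤s⁻¹ (≡.subst (leaves r ℕ.<_) e (ℕ.m<n+m _ (leaves>0 l))))
... | ≡.refl | ≡.refl = x , ≡.refl

3-leaves : {G : Set g} (t : Tree G) → leaves t ≡ 3 → ∃[ x ] ∃[ y ]
  (t ≡ node x (corolla y) leaf ⊎ t ≡ node x leaf (corolla y))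
3-leaves (node x leaf r) e with 2-leaves r (ℕ.suc-injective e)
... | y , ≡.refl = x , y , inj₂ ≡.refl
3-leaves (node x l@(node _ _ _) leaf) e with 2-leaves l (ℕ.+-cancelʳ-≡ 1 (leaves l) 2 e)
... | y , ≡.refl = x , y , inj₁ ≡.refl
3-leaves (node x (node _ a b) (node _ d e)) eq
  with ≡.subst (4 ℕ.≤_) eq (ℕ.+-mono-≤ (ℕ.+-mono-≤ (leaves>0 a) (leaves>0 b)) (ℕ.+-mono-≤ (leaves>0 d) (leaves>0 e)))
... | ℕ.s≤s (ℕ.s≤s (ℕ.s≤s ()))

-- Generators by direction

dias : ∀ {γ} → Dir → Fin γ → DiasGen γ
dias ◂ = ⊣
dias ▸ = ⊢

dendr : ∀ {γ} → Dir → Fin γ → DendrGen γ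
dendr ◂ = ≺
dendr ▸ = ≻

dias-injective : ∀ {γ} s {a b : Fin γ} → dias s a ≡ dias s b → a ≡ b
dias-injective ◂ ≡.refl = ≡.refl
dias-injective ▸ ≡.refl = ≡.refl

dias-disjoint : ∀ {γ} {s t} {a b : Fin γ} → s ≢ t → dias s a ≢ dias t b
dias-disjoint {s = ◂} {◂} s≢t _ = s≢t ≡.refl
dias-disjoint {s = ▸} {▸} s≢t _ = s≢t ≡.refl

-- Quadratic monomials, their images and coefficients

module Polydendriform (K : CommutativeRing c ℓ) (γ : ℕ) where
  open PolydendriformOperads K γ
  open FreeOperad K
  open LinearAlgebra K
  private
    module K = CommutativeRing K
    module R = RingProperties K.ring
  open K using (_≈_; _+_; _*_; 0#; 1#; -_) renaming (Carrier to Scalar)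
  private
    module F = Operad (Free (DiasGen γ))
    module D = Operad (Free (DendrGen γ))
    module SF {k} = Sums (F.space k)
    module SD {k} = Sums (D.space k)
    module SK = Sums scalars

  index : Dir → Fin 2
  index ◂ = zero
  index ▸ = suc zero

  join : {G : Set g} → Dir → (x y : Operad.Op (Free G) 2) → Operad.Op (Free G) 3
  join {G = G} d x y = x ∘[ index d ] y ⟨ ≡.refl ⟩
    where open Operad (Free G)

  module _ {G : Set g} where
    private module G = Operad (Free G)

    join-isLinearˡ : ∀ d (y : G.Op 2) → IsLinear (G.space 3) (λ x → join d x y)
    join-isLinearˡ d y = isLinear-∘ˡ (Free G) id-isLinear (index d) y ≡.refl

    join-isLinearʳ : ∀ d (x : G.Op 2) → IsLinear (G.space 3) (λ y → join d x y)
    join-isLinearʳ d x = isLinear-∘ʳ (Free G) id-isLinear x (index d) ≡.refl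

  diasMono : Shape → Fin γ → Fin γ → F.Op 3
  diasMono ⟪ d , s , t ⟫ a b = join d (gen (dias s a)) (gen (dias t b))

  dendrMono : Shape → Fin γ → Fin γ → D.Op 3
  dendrMono ⟪ d , s , t ⟫ a b = join d (gen (dendr s a)) (gen (dendr t b))

  -- By computation `image ◂` is `∑↼` and `image ▸` is `∑⇀`, since `partialSum` repeats their
  -- indexing.
  image : Dir → Fin γ → F.Op 2
  image s = SF.partialSum (λ a → gen (dias s a))

  imageMono : Shape → Fin γ → Fin γ → F.Op 3
  imageMono ⟪ d , s , t ⟫ a b = join d (image s a) (image t b)

  ⟨_,_⟩ : F.Op 3 → F.Op 3 → Scalar
  ⟨_,_⟩ = pairing _≟ᴰ_

  pairing-isLinear : ∀ r → IsLinear scalars ⟨ r ,_⟩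
  pairing-isLinear r = extend₂-isLinearʳ scalars _ r

  sign : Dir → Scalar
  sign ◂ = 1#
  sign ▸ = - 1#

  sign*sign≈1 : ∀ d → sign d * sign d ≈ 1#
  sign*sign≈1 ◂ = K.*-identityˡ 1#
  sign*sign≈1 ▸ = K.trans (R.-1*x≈-x _) (R.-‿involutive 1#)

  -- The sign cancels the one in the pairing.
  coefficient : Shape → Fin γ → Fin γ → F.Op 3 → Scalar
  coefficient σ a b f = sign (Shape.position σ) * ⟨ diasMono σ a b , f ⟩

  coefficient-isLinear : ∀ σ a b → IsLinear scalars (coefficient σ a b)
  coefficient-isLinear σ a b = isLinear-scale scalars (pairing-isLinear (diasMono σ a b)) _

  -- A tree with two leaves is determined by its root, so this reads off the coefficient of `gen x`.
  -- The value at `leaf` is a default that arity 2 never reaches.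
  rootIndicator : DiasGen γ → Tree (DiasGen γ) → Scalar
  rootIndicator x leaf         = 0#
  rootIndicator x (node y _ _) = indicator (x ≟ᴰ y)

  coefficient₂ : DiasGen γ → F.Op 2 → Scalar
  coefficient₂ x = extend scalars (rootIndicator x ∘ TreeOfArity.tree)

  coefficient₂-isLinear : ∀ x → IsLinear scalars (coefficient₂ x)
  coefficient₂-isLinear x = extend-isLinear scalars _

  arity₂ : {G : Set g} (t : TreeOfArity G 2) → ∃[ x ] [ t ] ≡ gen x
  arity₂ (t , e) with 2-leaves t (recompute (leaves t ℕ.≟ 2) e)
  ... | x , ≡.refl = x , ≡.refl

  -- Both sides are linear in `p` and in `q`, so generators suffice, and there the pairing computes.
  -- Coefficients in arity 3 thus become products of coefficients in arity 2.
  coefficient-join : ∀ d s t a b d′ p q → coefficient ⟪ d , s , t ⟫ a b (join d′ p q) ≈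
    indicator (d ≟ᵈ d′) * (coefficient₂ (dias s a) p * coefficient₂ (dias t b) q)
  coefficient-join d s t a b d′ p q =
    linear-unique scalars
      (∘-isLinear scalars (coefficient-isLinear ⟪ d , s , t ⟫ a b) (join-isLinearˡ d′ q))
      (isLinear-scale scalars (isLinear-*ₗ scalars (coefficient₂-isLinear _) _) _)
      (λ t₁ → linear-unique scalars
        (∘-isLinear scalars (coefficient-isLinear ⟪ d , s , t ⟫ a b) (join-isLinearʳ d′ [ t₁ ]))
        (isLinear-scale scalars (isLinear-scale scalars (coefficient₂-isLinear _) _) _)
        (λ t₂ → basis t₁ t₂) q)
      p
    where
    basis : ∀ t₁ t₂ → coefficient ⟪ d , s , t ⟫ a b (join d′ [ t₁ ] [ t₂ ]) ≈
      indicator (d ≟ᵈ d′) * (coefficient₂ (dias s a) [ t₁ ] * coefficient₂ (dias t b) [ t₂ ])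
    basis t₁ t₂ with arity₂ t₁ | arity₂ t₂
    ... | x , ≡.refl | y , ≡.refl = monomials d d′
      where
      monomials : ∀ d d′ → coefficient ⟪ d , s , t ⟫ a b (join d′ (gen x) (gen y)) ≈
        indicator (d ≟ᵈ d′) * (indicator (dias s a ≟ᴰ x) * indicator (dias t b ≟ᴰ y))
      monomials ◂ ◂ = K.*-congˡ (K.trans (if-∧ _ _ 1#) (K.*-identityˡ _))
      monomials ◂ ▸ = K.trans (K.zeroʳ _) (K.sym (K.zeroˡ _))
      monomials ▸ ◂ = K.trans (K.zeroʳ _) (K.sym (K.zeroˡ _))
      monomials ▸ ▸ = K.trans (K.*-congˡ (if-∧ _ _ (- 1#)))
        (K.trans (K.sym (K.*-assoc _ _ _)) (K.*-congʳ (sign*sign≈1 ▸)))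

  -- The zeta function of the chain `Fin γ`, which is the matrix of the change of generators.
  χ : Fin γ → Fin γ → Scalar
  χ a b = indicator (a Fin.≤? b)

  coefficient₂-image : ∀ s t a b → coefficient₂ (dias s a) (image t b) ≈
    SK.partialSum (λ i → indicator (dias s a ≟ᴰ dias t i)) b
  coefficient₂-image s t a b = sum-homo scalars (coefficient₂-isLinear (dias s a))
    {suc (toℕ b)} (λ i → gen (dias t (inject≤ i (Fin.toℕ<n b))))

  coefficient₂-image-same : ∀ s a b → coefficient₂ (dias s a) (image s b) ≈ χ a b
  coefficient₂-image-same s a b = begin
    coefficient₂ (dias s a) (image s b)                    ≈⟨ coefficient₂-image s s a b ⟩
    SK.partialSum (λ i → indicator (dias s a ≟ᴰ dias s i)) b
      ≈⟨ partialSum-indicator scalars _ b ⟩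
    SK.sum (λ i → χ i b * indicator (dias s a ≟ᴰ dias s i))
      ≈⟨ SK.sum-single {γ} a (λ i i≢a → K.trans (K.*-comm _ _)
           (indicator-no scalars (dias s a ≟ᴰ dias s i) (i≢a ∘ ≡.sym ∘ dias-injective s) _)) ⟩
    χ a b * indicator (dias s a ≟ᴰ dias s a)               ≈⟨ K.*-comm _ _ ⟩
    indicator (dias s a ≟ᴰ dias s a) * χ a b               ≈⟨ indicator-yes scalars (dias s a ≟ᴰ dias s a) ≡.refl _ ⟩
    χ a b                                                  ∎
    where open SetoidReasoning K.setoid

  coefficient₂-image-opposite : ∀ {s t} a b → s ≢ t → coefficient₂ (dias s a) (image t b) ≈ 0#
  coefficient₂-image-opposite {s} {t} a b s≢t = K.trans (coefficient₂-image s t a b)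
    (SK.sum-zero {suc (toℕ b)} (λ i → K.trans (K.sym (K.*-identityʳ _))
      (indicator-no scalars (dias s a ≟ᴰ dias t (inject≤ i (Fin.toℕ<n b))) (dias-disjoint s≢t) 1#)))

  coefficient-image-same : ∀ σ a b a′ b′ → coefficient σ a b (imageMono σ a′ b′) ≈ χ a a′ * χ b b′
  coefficient-image-same ⟪ d , s , t ⟫ a b a′ b′ = K.trans
    (coefficient-join d s t a b d (image s a′) (image t b′))
    (K.trans (indicator-yes scalars (d ≟ᵈ d) ≡.refl _)
      (K.*-cong (coefficient₂-image-same s a a′) (coefficient₂-image-same t b b′)))

  coefficient-image-other : ∀ {σ τ} a b a′ b′ → σ ≢ τ → coefficient σ a b (imageMono τ a′ b′) ≈ 0#
  coefficient-image-other {⟪ d , s , t ⟫} {⟪ d′ , s′ , t′ ⟫} a b a′ b′ σ≢τ =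
    K.trans (coefficient-join d s t a b d′ (image s′ a′) (image t′ b′)) (vanishes (d ≟ᵈ d′) (s ≟ᵈ s′) (t ≟ᵈ t′))
    where
    vanishes : (d? : Dec (d ≡ d′)) (s? : Dec (s ≡ s′)) (t? : Dec (t ≡ t′)) →
      indicator d? * (coefficient₂ (dias s a) (image s′ a′) * coefficient₂ (dias t b) (image t′ b′)) ≈ 0#
    vanishes (no _)   _        _        = K.zeroˡ _
    vanishes (yes _)  (no s≢)  _        = K.trans (K.*-congˡ
      (K.trans (K.*-congʳ (coefficient₂-image-opposite a a′ s≢)) (K.zeroˡ _))) (K.zeroʳ _)
    vanishes (yes _)  (yes _)  (no t≢)  = K.trans (K.*-congˡ
      (K.trans (K.*-congˡ (coefficient₂-image-opposite b b′ t≢)) (K.zeroʳ _))) (K.zeroʳ _)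
    vanishes (yes ≡.refl) (yes ≡.refl) (yes ≡.refl) = contradiction ≡.refl σ≢τ

  -- Relators of Dias and their pairings with images

  -- Relators are indexed by the pair of indices of their normal monomial.
  leadingArgs : Kind → Fin γ → Fin γ → Fin γ × Fin γ
  leadingArgs swap      a b = b , a
  leadingArgs (inner _) a b = a , a ↑ b
  leadingArgs (outer _) a b = a ↑ b , a

  relator : Kind → Fin γ → Fin γ → F.Op 3
  relator k a b = orient k (uncurry (diasMono (leading k)) (leadingArgs k a b)) (diasMono (normal k) a b)
    where
    -- The `∘₁` monomial comes first, as in `DiasRelator`, so each relator matches a constructor by
    -- computation.
    orient : Kind → F.Op 3 → F.Op 3 → F.Op 3
    orient swap      x y = x F.+ᴹ F.-ᴹ y
    orient (inner ◂) x y = x F.+ᴹ F.-ᴹ y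
    orient (inner ▸) x y = y F.+ᴹ F.-ᴹ x
    orient (outer ◂) x y = x F.+ᴹ F.-ᴹ y
    orient (outer ▸) x y = y F.+ᴹ F.-ᴹ x

  relator∈ : ∀ k a b → DiasRelator (relator k a b)
  relator∈ swap      a b = ⊣∘⊢ b a
  relator∈ (inner ◂) a b = ⊣∘⊣ a b
  relator∈ (inner ▸) a b = ⊢∘⊣ a b
  relator∈ (outer ◂) a b = ⊣↑∘⊣ a b
  relator∈ (outer ▸) a b = ⊢∘⊢ a b

  -- A relator is a `∘₁` monomial minus a `∘₂` monomial, and the pairing is negative on the latter.
  -- The two signs cancel, so the coefficients add up.
  pairing-relator : ∀ k a b f → ⟨ relator k a b , f ⟩ ≈
    uncurry (coefficient (leading k)) (leadingArgs k a b) f + coefficient (normal k) a b f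
  pairing-relator swap      a b f = K.+-congʳ (K.sym (K.*-identityˡ _))
  pairing-relator (inner ◂) a b f = K.+-congʳ (K.sym (K.*-identityˡ _))
  pairing-relator (inner ▸) a b f = K.trans (K.+-comm _ _) (K.+-congˡ (K.sym (K.*-identityˡ _)))
  pairing-relator (outer ◂) a b f = K.+-congʳ (K.sym (K.*-identityˡ _))
  pairing-relator (outer ▸) a b f = K.trans (K.+-comm _ _) (K.+-congˡ (K.sym (K.*-identityˡ _)))

  -- The pairing is linear in its first argument, so vanishing passes from the relators to their
  -- span.
  annihilates : ∀ {f} → (∀ k a b → ⟨ relator k a b , f ⟩ ≈ 0#) → Annihilator _≟ᴰ_ DiasRelations f
  annihilates {f} ann = go
    where
    module L = IsLinear (extend₂-isLinearˡ scalars (λ s t → treePairing _≟ᴰ_ (TreeOfArity.tree s) (TreeOfArity.tree t)) f)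
    go : ∀ r → r ∈ DiasRelations → ⟨ r , f ⟩ ≈ 0#
    go _ (generator (⊣∘⊢ a b))  = ann swap b a
    go _ (generator (⊣∘⊣ a b))  = ann (inner ◂) a b
    go _ (generator (⊢∘⊣ a b))  = ann (inner ▸) a b
    go _ (generator (⊣↑∘⊣ a b)) = ann (outer ◂) a b
    go _ (generator (⊢∘⊢ a b))  = ann (outer ▸) a b
    go _ zero                   = K.refl
    go _ (plus p q)             = K.trans (K.+-cong (go _ p) (go _ q)) (K.+-identityˡ 0#)
    go _ (scale a p)            = K.trans (K.*-congˡ (go _ p)) (K.zeroʳ a)
    go _ (resp x≋y p)           = K.trans (K.sym (L.cong x≋y)) (go _ p)

  -- Images of different shapes have no monomial in common, so only the normal monomial of the
  -- relator contributes.
  pairing-image-normal : ∀ k l a b a′ b′ → ⟨ relator k a b , imageMono (normal l) a′ b′ ⟩ ≈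
    coefficient (normal k) a b (imageMono (normal l) a′ b′)
  pairing-image-normal k l a b a′ b′ = K.trans (pairing-relator k a b (imageMono (normal l) a′ b′))
    (K.trans (K.+-congʳ (coefficient-image-other _ _ a′ b′ (leading≢normal k l))) (K.+-identityˡ _))

  pairing-image-leading : ∀ k l a b a′ b′ → ⟨ relator k a b , imageMono (leading l) a′ b′ ⟩ ≈
    uncurry (coefficient (leading k)) (leadingArgs k a b) (imageMono (leading l) a′ b′)
  pairing-image-leading k l a b a′ b′ = K.trans (pairing-relator k a b (imageMono (leading l) a′ b′))
    (K.trans (K.+-congˡ (coefficient-image-other a b a′ b′ (leading≢normal l k ∘ ≡.sym))) (K.+-identityʳ _))

  -- Reduction to normal monomials

  imageMono-expand : ∀ σ a′ b′ → imageMono σ a′ b′ ≋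
    SF.sum (λ a → SF.sum (λ b → (χ a a′ * χ b b′) ⊙ diasMono σ a b))
  imageMono-expand ⟪ d , s , t ⟫ a′ b′ = begin
    join d (image s a′) (image t b′)
      ≈⟨ IsLinear.cong (join-isLinearˡ d (image t b′)) (partialSum-indicator (F.space 2) x a′) ⟩
    join d (SF.sum (λ a → χ a a′ ⊙ x a)) (image t b′)
      ≈⟨ sum-homo (F.space 3) (join-isLinearˡ d (image t b′)) (λ a → χ a a′ ⊙ x a) ⟩
    SF.sum (λ a → χ a a′ ⊙ join d (x a) (image t b′))
      ≈⟨ SF.sum-cong-≋ {n = γ} (λ a → trans
           (⊙-cong K.refl (trans
             (IsLinear.cong (join-isLinearʳ d (x a)) (partialSum-indicator (F.space 2) y b′))
             (sum-homo (F.space 3) (join-isLinearʳ d (x a)) (λ b → χ b b′ ⊙ y b))))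
           (trans (SF.*ₗ-distribˡ-sum {n = γ} (χ a a′) (λ b → join d (x a) (χ b b′ ⊙ y b)))
           (SF.sum-cong-≋ {n = γ} (λ b → sym (⊙-assoc (χ a a′) (χ b b′) (join d (x a) (y b))))))) ⟩
    SF.sum (λ a → SF.sum (λ b → (χ a a′ * χ b b′) ⊙ join d (x a) (y b))) ∎
    where
    x y : Fin γ → F.Op 2
    x a = gen (dias s a)
    y b = gen (dias t b)
    open SetoidReasoning (F.≈ᴹ-setoid {3})

  -- The weight is the pairing with the whole relator, not the coefficient of its normal monomial.
  -- Hence `reduce f` depends only on the pairings of `f` with the relators.
  component : Kind → F.Op 3 → F.Op 3
  component k f = SF.sum (λ a → SF.sum (λ b → ⟨ relator k a b , f ⟩ ⊙ diasMono (normal k) a b))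

  reduce : F.Op 3 → F.Op 3
  reduce f = SF.sum (λ i → component (toKind i) f)

  reduce-isLinear : IsLinear (F.space 3) reduce
  reduce-isLinear =
    isLinear-sum (F.space 3) λ i → isLinear-sum (F.space 3) λ a → isLinear-sum (F.space 3) λ b →
      isLinear-*ₗ (F.space 3) (pairing-isLinear (relator (toKind i) a b)) (diasMono (normal (toKind i)) a b)

  monomial-sum-cong : ∀ σ {r s : Fin γ → Fin γ → Scalar} → (∀ a b → r a b ≈ s a b) →
    SF.sum (λ a → SF.sum (λ b → r a b ⊙ diasMono σ a b)) ≋ SF.sum (λ a → SF.sum (λ b → s a b ⊙ diasMono σ a b))
  monomial-sum-cong σ r≈s = SF.sum-cong-≋ {n = γ} (λ a → SF.sum-cong-≋ {n = γ} (λ b →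
    ⊙-cong (r≈s a b) (refl {x = diasMono σ a b})))

  reduce-cong : ∀ {f g} → (∀ k a b → ⟨ relator k a b , f ⟩ ≈ ⟨ relator k a b , g ⟩) → reduce f ≋ reduce g
  reduce-cong e = SF.sum-cong-≋ {n = 5} (λ i → monomial-sum-cong (normal (toKind i)) (e (toKind i)))

  -- Injectivity of `normal` kills the components of other kinds. In kind `l` the pairings are the
  -- coefficients of the image itself, which `imageMono-expand` reassembles.
  reduce-normal : ∀ l a′ b′ → reduce (imageMono (normal l) a′ b′) ≋ imageMono (normal l) a′ b′
  reduce-normal l a′ b′ = begin
    reduce f              ≈⟨ SF.sum-single {n = 5} (fromKind l) others ⟩
    component (toKind (fromKind l)) f ≡⟨ ≡.cong (λ k → component k f) (toKind-fromKind l) ⟩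
    component l f         ≈⟨ monomial-sum-cong (normal l) (λ a b →
                               K.trans (pairing-image-normal l l a b a′ b′) (coefficient-image-same (normal l) a b a′ b′)) ⟩
    SF.sum (λ a → SF.sum (λ b → (χ a a′ * χ b b′) ⊙ diasMono (normal l) a b))
                          ≈⟨ imageMono-expand (normal l) a′ b′ ⟨
    f                     ∎
    where
    f = imageMono (normal l) a′ b′
    open SetoidReasoning (F.≈ᴹ-setoid {3})
    others : ∀ i → i ≢ fromKind l → component (toKind i) f ≋ 𝟘
    others i i≢ = SF.sum-zero {n = γ} (λ a → SF.sum-zero {n = γ} (λ b → trans
      (⊙-cong (K.trans (pairing-image-normal (toKind i) l a b a′ b′)
        (coefficient-image-other a b a′ b′ λ e →
          i≢ (≡.trans (≡.sym (fromKind-toKind i)) (≡.cong fromKind (normal-injective e)))))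
        (refl {x = diasMono (normal (toKind i)) a b}))
      (⊙-zero (diasMono (normal (toKind i)) a b))))

  -- Images of leading monomials

  private module Maximum = Max (Fin.≤-totalOrder γ)

  -- The graph of the minimum. Its three cases stay apart because `DendrRelator` treats them by
  -- separate constructors, while the pairing computations are uniform in `m`.
  data Minimum : (m a b : Fin γ) → Set where
    less    : ∀ {a b} → a Fin.< b → Minimum a a b
    equal   : ∀ {a} → Minimum a a a
    greater : ∀ {a b} → b Fin.< a → Minimum b a b

  minimum : ∀ a b → ∃[ m ] Minimum m a b
  minimum a b with Fin.<-cmp a b
  ... | tri< a<b _ _    = a , less a<b
  ... | tri≈ _ ≡.refl _ = a , equal
  ... | tri> _ _ b<a    = b , greater b<a

  χ-minimum : ∀ {m b c} a → Minimum m b c → χ a b * χ a c ≈ χ a m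
  χ-minimum {m} {b} {c} a (less b<c) =
    indicator-* (a Fin.≤? b) (a Fin.≤? c) (λ a≤b → ℕ.≤-trans a≤b (ℕ.<⇒≤ b<c))
  χ-minimum {m} a equal = indicator-* (a Fin.≤? m) (a Fin.≤? m) (λ a≤m → a≤m)
  χ-minimum {m} {b} {c} a (greater c<b) = K.trans (K.*-comm _ _)
    (indicator-* (a Fin.≤? c) (a Fin.≤? b) (λ a≤c → ℕ.≤-trans a≤c (ℕ.<⇒≤ c<b)))

  χ-maximum : ∀ a b c → χ (a ↑ b) c ≈ χ a c * χ b c
  χ-maximum a b c with Fin.≤-total a b
  ... | inj₁ a≤b rewrite Maximum.x≤y⇒x⊔y≈y a≤b = K.sym (K.trans (K.*-comm _ _)
    (indicator-* (b Fin.≤? c) (a Fin.≤? c) (ℕ.≤-trans a≤b)))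
  ... | inj₂ b≤a rewrite Maximum.x≤y⇒y⊔x≈y b≤a = K.sym
    (indicator-* (a Fin.≤? c) (b Fin.≤? c) (ℕ.≤-trans b≤a))

  -- Only relators of kind `swap` see either side, and for them the two products of `χ` differ by
  -- the order of their factors.
  pairing-image-swap : ∀ k a b a′ b′ → ⟨ relator k a b , imageMono (leading swap) a′ b′ ⟩ ≈
                                       ⟨ relator k a b , imageMono (normal swap) b′ a′ ⟩
  pairing-image-swap k a b a′ b′ = K.trans (pairing-image-leading k swap a b a′ b′)
    (K.trans (coefficients k) (K.sym (pairing-image-normal k swap a b b′ a′)))
    where
    coefficients : ∀ k → uncurry (coefficient (leading k)) (leadingArgs k a b) (imageMono (leading swap) a′ b′) ≈
                         coefficient (normal k) a b (imageMono (normal swap) b′ a′)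
    coefficients swap = K.trans (coefficient-image-same (leading swap) b a a′ b′)
      (K.trans (K.*-comm _ _) (K.sym (coefficient-image-same (normal swap) a b b′ a′)))
    coefficients (inner s) = K.trans (coefficient-image-other {⟪ s , s , s ⟫} a (a ↑ b) a′ b′ λ ())
      (K.sym (coefficient-image-other a b b′ a′ λ e → contradiction (normal-injective {inner s} {swap} e) λ ()))
    coefficients (outer s) = K.trans (coefficient-image-other {⟪ s , s , s ⟫} (a ↑ b) a a′ b′ λ ())
      (K.sym (coefficient-image-other a b b′ a′ λ e → contradiction (normal-injective {outer s} {swap} e) λ ()))

  -- For the kinds `inner s` and `outer s` exactly one summand on the right survives: the bound on
  -- `a ↑ b` splits into bounds on `a` and `b`, and the two bounds on `a` merge into `m`. For all
  -- other kinds both sides vanish.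
  pairing-image-expand : ∀ s {m a′ b′} → Minimum m a′ b′ → ∀ k a b →
    ⟨ relator k a b , imageMono ⟪ s , s , s ⟫ a′ b′ ⟩ ≈
    ⟨ relator k a b , imageMono (normal (inner s)) m b′ ⟩ + ⟨ relator k a b , imageMono (normal (outer s)) m a′ ⟩
  pairing-image-expand s {m} {a′} {b′} min k a b = K.trans (pairing-image-leading k (inner s) a b a′ b′)
    (K.trans (coefficients k)
      (K.sym (K.+-cong (pairing-image-normal k (inner s) a b m b′) (pairing-image-normal k (outer s) a b m a′))))
    where
    other : ∀ k l c d → k ≢ l → coefficient (normal k) a b (imageMono (normal l) c d) ≈ 0#
    other k l c d k≢l = coefficient-image-other a b c d (k≢l ∘ normal-injective)
    open SetoidReasoning K.setoid
    coefficients : ∀ k → uncurry (coefficient (leading k)) (leadingArgs k a b) (imageMono ⟪ s , s , s ⟫ a′ b′) ≈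
      coefficient (normal k) a b (imageMono (normal (inner s)) m b′) +
      coefficient (normal k) a b (imageMono (normal (outer s)) m a′)
    coefficients swap = K.trans (coefficient-image-other {leading swap} b a a′ b′ λ ())
      (K.sym (K.trans (K.+-cong (other swap (inner s) m b′ λ ()) (other swap (outer s) m a′ λ ())) (K.+-identityˡ 0#)))
    coefficients (inner t) with t ≟ᵈ s
    ... | yes ≡.refl = begin
      coefficient ⟪ s , s , s ⟫ a (a ↑ b) (imageMono ⟪ s , s , s ⟫ a′ b′)
                                    ≈⟨ coefficient-image-same ⟪ s , s , s ⟫ a (a ↑ b) a′ b′ ⟩
      χ a a′ * χ (a ↑ b) b′         ≈⟨ K.*-congˡ (χ-maximum a b b′) ⟩
      χ a a′ * (χ a b′ * χ b b′)    ≈⟨ K.*-assoc _ _ _ ⟨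
      (χ a a′ * χ a b′) * χ b b′    ≈⟨ K.*-congʳ (χ-minimum a min) ⟩
      χ a m * χ b b′                ≈⟨ K.+-identityʳ _ ⟨
      χ a m * χ b b′ + 0#           ≈⟨ K.+-cong (coefficient-image-same (normal (inner s)) a b m b′)
                                         (other (inner s) (outer s) m a′ λ ()) ⟨
      coefficient (normal (inner s)) a b (imageMono (normal (inner s)) m b′) +
      coefficient (normal (inner s)) a b (imageMono (normal (outer s)) m a′) ∎
    ... | no t≢s = K.trans (coefficient-image-other a (a ↑ b) a′ b′ (t≢s ∘ ≡.cong Shape.position))
      (K.sym (K.trans (K.+-cong (other (inner t) (inner s) m b′ λ { ≡.refl → t≢s ≡.refl })
        (other (inner t) (outer s) m a′ λ ())) (K.+-identityˡ 0#)))
    coefficients (outer t) with t ≟ᵈ s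
    ... | yes ≡.refl = begin
      coefficient ⟪ s , s , s ⟫ (a ↑ b) a (imageMono ⟪ s , s , s ⟫ a′ b′)
                                    ≈⟨ coefficient-image-same ⟪ s , s , s ⟫ (a ↑ b) a a′ b′ ⟩
      χ (a ↑ b) a′ * χ a b′         ≈⟨ K.*-congʳ (χ-maximum a b a′) ⟩
      (χ a a′ * χ b a′) * χ a b′    ≈⟨ xy∙z≈xz∙y _ _ _ ⟩
      (χ a a′ * χ a b′) * χ b a′    ≈⟨ K.*-congʳ (χ-minimum a min) ⟩
      χ a m * χ b a′                ≈⟨ K.+-identityˡ _ ⟨
      0# + χ a m * χ b a′           ≈⟨ K.+-cong (other (outer s) (inner s) m b′ λ ())
                                         (coefficient-image-same (normal (outer s)) a b m a′) ⟨
      coefficient (normal (outer s)) a b (imageMono (normal (inner s)) m b′) +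
      coefficient (normal (outer s)) a b (imageMono (normal (outer s)) m a′) ∎
      where open CommutativeSemigroupProperties (CommutativeMonoid.commutativeSemigroup K.*-commutativeMonoid)
    ... | no t≢s = K.trans (coefficient-image-other (a ↑ b) a a′ b′ (t≢s ∘ ≡.cong Shape.position))
      (K.sym (K.trans (K.+-cong (other (outer t) (inner s) m b′ λ ())
        (other (outer t) (outer s) m a′ λ { ≡.refl → t≢s ≡.refl })) (K.+-identityˡ 0#)))

  -- Relations of Dendr as expansions of leading monomials

  -- The four ways in which rel₂ to rel₇ arrange the terms of u = y + z.
  private
    module _ (u y z : D.Op 3) where
      open AbelianGroupProperties (D.+ᴹ-abelianGroup {3})

      u-y-z : sign ◂ ⊙ (u D.+ᴹ D.-ᴹ (y D.+ᴹ z)) ≋ (u D.+ᴹ D.-ᴹ y) D.+ᴹ D.-ᴹ z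
      u-y-z = trans (⊙-one _) (trans (⊕-cong refl (sym (⁻¹-∙-comm y z))) (sym (⊕-assoc u (D.-ᴹ y) (D.-ᴹ z))))

      y+z-u : sign ▸ ⊙ (u D.+ᴹ D.-ᴹ (y D.+ᴹ z)) ≋ (y D.+ᴹ z) D.+ᴹ D.-ᴹ u
      y+z-u = ⁻¹-anti-homo‿- u (y D.+ᴹ z)

    module _ (u y z : D.Op 3) where
      commute : u D.+ᴹ D.-ᴹ (y D.+ᴹ z) ≋ u D.+ᴹ D.-ᴹ (z D.+ᴹ y)
      commute = ⊕-cong refl (⊙-cong K.refl (⊕-comm y z))

      u-z-y : sign ◂ ⊙ (u D.+ᴹ D.-ᴹ (y D.+ᴹ z)) ≋ (u D.+ᴹ D.-ᴹ z) D.+ᴹ D.-ᴹ y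
      u-z-y = trans (⊙-cong K.refl commute) (u-y-z u z y)

      z+y-u : sign ▸ ⊙ (u D.+ᴹ D.-ᴹ (y D.+ᴹ z)) ≋ (z D.+ᴹ y) D.+ᴹ D.-ᴹ u
      z+y-u = trans (⊙-cong K.refl commute) (y+z-u u z y)

  -- The factor `sign s` is there because for `▸` the leading monomial is a `∘₂` monomial, which
  -- enters the relators with a minus sign.
  expansion : ∀ s {m a b} → Minimum m a b → D.Op 3
  expansion s {m} {a} {b} _ = sign s ⊙ (dendrMono ⟪ s , s , s ⟫ a b D.+ᴹ
    D.-ᴹ (dendrMono (normal (inner s)) m b D.+ᴹ dendrMono (normal (outer s)) m a))

  expansion∈DendrRelations : ∀ s {m a b} (min : Minimum m a b) → expansion s min ∈ DendrRelations
  expansion∈DendrRelations ◂ (less a<b)    = resp (sym (u-y-z _ _ _)) (generator (rel₂ a<b))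
  expansion∈DendrRelations ◂ equal         = resp (sym (u-y-z _ _ _)) (generator (rel₆ _))
  expansion∈DendrRelations ◂ (greater b<a) = resp (sym (u-z-y _ _ _)) (generator (rel₄ b<a))
  expansion∈DendrRelations ▸ (less a<b)    = resp (sym (z+y-u _ _ _)) (generator (rel₃ a<b))
  expansion∈DendrRelations ▸ equal         = resp (sym (z+y-u _ _ _)) (generator (rel₇ _))
  expansion∈DendrRelations ▸ (greater b<a) = resp (sym (y+z-u _ _ _)) (generator (rel₅ b<a))

  -- The change of generators and its inverse

  generatorImage : DendrGen γ → F.Op 2
  generatorImage (≺ b) = ∑↼ b
  generatorImage (≻ b) = ∑⇀ b

  generatorPreimage : DiasGen γ → D.Op 2
  generatorPreimage (⊣ a) = SD.difference (λ b → gen (≺ b)) a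
  generatorPreimage (⊢ a) = SD.difference (λ b → gen (≻ b)) a

  φ : FreeMorphism (DendrGen γ) (Free (DiasGen γ))
  φ = lift (Free (DiasGen γ)) generatorImage

  ψ : FreeMorphism (DiasGen γ) (Free (DendrGen γ))
  ψ = lift (Free (DendrGen γ)) generatorPreimage

  private
    module φ = FreeMorphism φ
    module ψ = FreeMorphism ψ

  φ-gen : ∀ x → φ.⟦ gen x ⟧ ≋ generatorImage x
  φ-gen = lift-gen (Free (DiasGen γ)) generatorImage

  ψ-gen : ∀ y → ψ.⟦ gen y ⟧ ≋ generatorPreimage y
  ψ-gen = lift-gen (Free (DendrGen γ)) generatorPreimage

  φ-dendr : ∀ s b → φ.⟦ gen (dendr s b) ⟧ ≋ image s b
  φ-dendr ◂ b = φ-gen (≺ b)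
  φ-dendr ▸ b = φ-gen (≻ b)

  ψ-dias : ∀ s a → ψ.⟦ gen (dias s a) ⟧ ≋ SD.difference (λ b → gen (dendr s b)) a
  ψ-dias ◂ a = ψ-gen (⊣ a)
  ψ-dias ▸ a = ψ-gen (⊢ a)

  ψφ-dendr : ∀ s b → ψ.⟦ φ.⟦ gen (dendr s b) ⟧ ⟧ ≋ gen (dendr s b)
  ψφ-dendr s b = begin
    ψ.⟦ φ.⟦ gen (dendr s b) ⟧ ⟧ ≈⟨ ψ.cong (φ-dendr s b) ⟩
    ψ.⟦ image s b ⟧ ≈⟨ sum-homo (D.space 2) ψ.isLinear {suc (toℕ b)} (λ a → gen (dias s (inject≤ a (Fin.toℕ<n b)))) ⟩
    SD.partialSum (λ a → ψ.⟦ gen (dias s a) ⟧) b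
      ≈⟨ SD.sum-cong-≋ {n = suc (toℕ b)} (λ a → ψ-dias s (inject≤ a (Fin.toℕ<n b))) ⟩
    SD.partialSum (SD.difference (λ b → gen (dendr s b))) b ≈⟨ SD.partialSum-difference (λ b → gen (dendr s b)) b ⟩
    gen (dendr s b) ∎
    where open SetoidReasoning (D.≈ᴹ-setoid {2})

  φψ-dias : ∀ s a → φ.⟦ ψ.⟦ gen (dias s a) ⟧ ⟧ ≋ gen (dias s a)
  φψ-dias s a = begin
    φ.⟦ ψ.⟦ gen (dias s a) ⟧ ⟧ ≈⟨ φ.cong (ψ-dias s a) ⟩
    φ.⟦ SD.difference (λ b → gen (dendr s b)) a ⟧ ≈⟨ difference-homo (F.space 2) φ.isLinear (λ b → gen (dendr s b)) a ⟩
    SF.difference (λ b → φ.⟦ gen (dendr s b) ⟧) a ≈⟨ SF.difference-cong (φ-dendr s) a ⟩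
    SF.difference (image s) a                    ≈⟨ SF.difference-partialSum (λ a → gen (dias s a)) a ⟩
    gen (dias s a)                               ∎
    where open SetoidReasoning (F.≈ᴹ-setoid {2})

  ψφ-gen : ∀ x → ψ.⟦ φ.⟦ gen x ⟧ ⟧ ≋ gen x
  ψφ-gen (≺ b) = ψφ-dendr ◂ b
  ψφ-gen (≻ b) = ψφ-dendr ▸ b

  φψ-gen : ∀ y → φ.⟦ ψ.⟦ gen y ⟧ ⟧ ≋ gen y
  φψ-gen (⊣ a) = φψ-dias ◂ a
  φψ-gen (⊢ a) = φψ-dias ▸ a

  φ-mono : ∀ σ a b → φ.⟦ dendrMono σ a b ⟧ ≋ imageMono σ a b
  φ-mono ⟪ d , s , t ⟫ a b = trans (φ.∘-homo (gen (dendr s a)) (index d) (gen (dendr t b)) ≡.refl)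
    (F.∘-cong (index d) ≡.refl (φ-dendr s a) (φ-dendr t b))

  -- Relations of Dendr are sent into the annihilator

  private
    module pairing-φ r = IsLinear (∘-isLinear scalars (pairing-isLinear r) φ.isLinear)

  pairing-φ-mono : ∀ r σ a b → ⟨ r , φ.⟦ dendrMono σ a b ⟧ ⟩ ≈ ⟨ r , imageMono σ a b ⟩
  pairing-φ-mono r σ a b = IsLinear.cong (pairing-isLinear r) (φ-mono σ a b)

  pairing-φ-swap : ∀ k a b a′ b′ → ⟨ relator k a b , φ.⟦ dendrMono (leading swap) a′ b′ ⟧ ⟩ ≈
                                   ⟨ relator k a b , φ.⟦ dendrMono (normal swap) b′ a′ ⟧ ⟩
  pairing-φ-swap k a b a′ b′ = K.trans (pairing-φ-mono (relator k a b) (leading swap) a′ b′)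
    (K.trans (pairing-image-swap k a b a′ b′) (K.sym (pairing-φ-mono (relator k a b) (normal swap) b′ a′)))

  pairing-φ-expand : ∀ s {m a′ b′} → Minimum m a′ b′ → ∀ k a b →
    ⟨ relator k a b , φ.⟦ dendrMono ⟪ s , s , s ⟫ a′ b′ ⟧ ⟩ ≈
    ⟨ relator k a b , φ.⟦ dendrMono (normal (inner s)) m b′ D.+ᴹ dendrMono (normal (outer s)) m a′ ⟧ ⟩
  pairing-φ-expand s {m} {a′} {b′} min k a b = K.trans (pairing-φ-mono r ⟪ s , s , s ⟫ a′ b′)
    (K.trans (pairing-image-expand s min k a b)
      (K.sym (K.trans (pairing-φ.+-homo r (dendrMono (normal (inner s)) m b′) (dendrMono (normal (outer s)) m a′))
        (K.+-cong (pairing-φ-mono r (normal (inner s)) m b′) (pairing-φ-mono r (normal (outer s)) m a′)))))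
    where r = relator k a b

  pairing-φ-difference : ∀ r x y → ⟨ r , φ.⟦ x ⟧ ⟩ ≈ ⟨ r , φ.⟦ y ⟧ ⟩ → ⟨ r , φ.⟦ x D.+ᴹ D.-ᴹ y ⟧ ⟩ ≈ 0#
  pairing-φ-difference r x y e = begin
    ⟨ r , φ.⟦ x D.+ᴹ D.-ᴹ y ⟧ ⟩                    ≈⟨ pairing-φ.+-homo r x (D.-ᴹ y) ⟩
    ⟨ r , φ.⟦ x ⟧ ⟩ + ⟨ r , φ.⟦ D.-ᴹ y ⟧ ⟩          ≈⟨ K.+-cong e (pairing-φ.*ₗ-homo r (- 1#) y) ⟩
    ⟨ r , φ.⟦ y ⟧ ⟩ + (- 1#) * ⟨ r , φ.⟦ y ⟧ ⟩      ≈⟨ K.+-congˡ (R.-1*x≈-x ⟨ r , φ.⟦ y ⟧ ⟩) ⟩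
    ⟨ r , φ.⟦ y ⟧ ⟩ + - ⟨ r , φ.⟦ y ⟧ ⟩             ≈⟨ K.-‿inverseʳ ⟨ r , φ.⟦ y ⟧ ⟩ ⟩
    0#                                             ∎
    where open SetoidReasoning K.setoid

  -- Stated up to `≋`, so that each relator enters with its terms arranged as in `DendrRelator`.
  pairing-φ-expansion : ∀ s {m a′ b′} (min : Minimum m a′ b′) {x} → expansion s min ≋ x →
                       ∀ k a b → ⟨ relator k a b , φ.⟦ x ⟧ ⟩ ≈ 0#
  pairing-φ-expansion s {m} {a′} {b′} min {x} e≋x k a b = begin
    ⟨ r , φ.⟦ x ⟧ ⟩                    ≈⟨ pairing-φ.cong r e≋x ⟨
    ⟨ r , φ.⟦ expansion s min ⟧ ⟩       ≈⟨ pairing-φ.*ₗ-homo r (sign s) (u D.+ᴹ D.-ᴹ v) ⟩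
    sign s * ⟨ r , φ.⟦ u D.+ᴹ D.-ᴹ v ⟧ ⟩ ≈⟨ K.*-congˡ {sign s} (pairing-φ-difference r u v (pairing-φ-expand s min k a b)) ⟩
    sign s * 0#                        ≈⟨ K.zeroʳ (sign s) ⟩
    0#                                 ∎
    where
    open SetoidReasoning K.setoid
    r = relator k a b
    u = dendrMono ⟪ s , s , s ⟫ a′ b′
    v = dendrMono (normal (inner s)) m b′ D.+ᴹ dendrMono (normal (outer s)) m a′

  φ-DendrRelator : ∀ {r} → DendrRelator r → ∀ k a b → ⟨ relator k a b , φ.⟦ r ⟧ ⟩ ≈ 0#
  φ-DendrRelator (rel₁ a′ b′) = λ k a b → pairing-φ-difference (relator k a b)
    (dendrMono (leading swap) a′ b′) (dendrMono (normal swap) b′ a′) (pairing-φ-swap k a b a′ b′)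
  φ-DendrRelator (rel₂ a<b)   = pairing-φ-expansion ◂ (less a<b)    (u-y-z _ _ _)
  φ-DendrRelator (rel₃ a<b)   = pairing-φ-expansion ▸ (less a<b)    (z+y-u _ _ _)
  φ-DendrRelator (rel₄ a<b)   = pairing-φ-expansion ◂ (greater a<b) (u-z-y _ _ _)
  φ-DendrRelator (rel₅ a<b)   = pairing-φ-expansion ▸ (greater a<b) (y+z-u _ _ _)
  φ-DendrRelator (rel₆ a′)    = pairing-φ-expansion ◂ (equal {a′})  (u-y-z _ _ _)
  φ-DendrRelator (rel₇ a′)    = pairing-φ-expansion ▸ (equal {a′})  (z+y-u _ _ _)

  φ-DendrRelations : ∀ {x} → x ∈ DendrRelations → ∀ k a b → ⟨ relator k a b , φ.⟦ x ⟧ ⟩ ≈ 0#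
  φ-DendrRelations x∈R k a b = go x∈R
    where
    r = relator k a b
    go : ∀ {x} → x ∈ DendrRelations → ⟨ r , φ.⟦ x ⟧ ⟩ ≈ 0#
    go (generator r)         = φ-DendrRelator r k a b
    go zero                  = pairing-φ.0-homo r
    go (plus {x} {y} p q)    = K.trans (pairing-φ.+-homo r x y) (K.trans (K.+-cong (go p) (go q)) (K.+-identityˡ 0#))
    go (scale a {x} p)       = K.trans (pairing-φ.*ₗ-homo r a x) (K.trans (K.*-congˡ (go p)) (K.zeroʳ a))
    go (resp {x} {y} x≋y p)  = K.trans (K.sym (pairing-φ.cong r {x} {y} x≋y)) (go p)

  DendrRelations⊆Annihilator : ∀ {x} → x ∈ DendrRelations →
    φ.⟦ x ⟧ ∈ Ideal (Free (DiasGen γ)) (Annihilator _≟ᴰ_ DiasRelations)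
  DendrRelations⊆Annihilator {x} x∈R = generator (annihilates {φ.⟦ x ⟧} (φ-DendrRelations {x} x∈R))

  -- The annihilator is sent into the ideal of the relations

  infix 4 _≈ᴰ_

  _≈ᴰ_ : D.Op 3 → D.Op 3 → Set _
  _≈ᴰ_ = Operad._≈ᴹ_ (Free (DendrGen γ) /⟨ DendrRelations ⟩)

  private
    module Q = Operad (Free (DendrGen γ) /⟨ DendrRelations ⟩)

  ≋⇒≈ᴰ : ∀ {x y : D.Op 3} → x ≋ y → x ≈ᴰ y
  ≋⇒≈ᴰ = ≈⇒∼ (Free (DendrGen γ)) DendrRelations

  ψ-reduce-φ : D.Op 3 → D.Op 3
  ψ-reduce-φ x = ψ.⟦ reduce φ.⟦ x ⟧ ⟧

  ψ-reduce-φ-isLinear : IsLinear (D.space 3) ψ-reduce-φ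
  ψ-reduce-φ-isLinear = ∘-isLinear (D.space 3) ψ.isLinear (∘-isLinear (F.space 3) reduce-isLinear φ.isLinear)

  ψ-reduce-φ-normal : ∀ k a b → ψ-reduce-φ (dendrMono (normal k) a b) ≋ dendrMono (normal k) a b
  ψ-reduce-φ-normal k a b = begin
    ψ.⟦ reduce φ.⟦ x ⟧ ⟧                     ≈⟨ ψ.cong (IsLinear.cong reduce-isLinear (φ-mono (normal k) a b)) ⟩
    ψ.⟦ reduce (imageMono (normal k) a b) ⟧  ≈⟨ ψ.cong (reduce-normal k a b) ⟩
    ψ.⟦ imageMono (normal k) a b ⟧           ≈⟨ ψ.cong (φ-mono (normal k) a b) ⟨
    ψ.⟦ φ.⟦ x ⟧ ⟧                            ≈⟨ leftInverse φ ψ ψφ-gen x ⟩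
    x                                        ∎
    where
    x = dendrMono (normal k) a b
    open SetoidReasoning (D.≈ᴹ-setoid {3})

  -- The leading monomial and its expansion have equal pairings with all relators, so `reduce`
  -- cannot tell their images apart; the expansion is fixed, and it equals the leading monomial
  -- modulo the relations.
  ψ-reduce-φ-expansion : ∀ s {m a b} → Minimum m a b →
    ψ-reduce-φ (dendrMono ⟪ s , s , s ⟫ a b) ≈ᴰ dendrMono ⟪ s , s , s ⟫ a b
  ψ-reduce-φ-expansion s {m} {a} {b} min = begin
    ψ-reduce-φ u        ≈⟨ ≋⇒≈ᴰ (ψ.cong (reduce-cong {φ.⟦ u ⟧} {φ.⟦ y ⊕ z ⟧} (pairing-φ-expand s min))) ⟩
    ψ-reduce-φ (y ⊕ z)  ≈⟨ ≋⇒≈ᴰ (IsLinear.+-homo ψ-reduce-φ-isLinear y z) ⟩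
    ψ-reduce-φ y ⊕ ψ-reduce-φ z
      ≈⟨ ≋⇒≈ᴰ (⊕-cong (ψ-reduce-φ-normal (inner s) m b) (ψ-reduce-φ-normal (outer s) m a)) ⟩
    y ⊕ z               ≈⟨ Q.≈ᴹ-sym (unsign (expansion∈DendrRelations s min)) ⟩
    u                   ∎
    where
    u = dendrMono ⟪ s , s , s ⟫ a b
    y = dendrMono (normal (inner s)) m b
    z = dendrMono (normal (outer s)) m a
    open SetoidReasoning (Q.≈ᴹ-setoid {3})
    -- Scaling once more by `sign s` removes the factor, since the sign squares to `1#`.
    unsign : sign s ⊙ (u D.+ᴹ D.-ᴹ (y ⊕ z)) ∈ DendrRelations → u ≈ᴰ y ⊕ z
    unsign p = resp (trans (sym (⊙-assoc _ _ _)) (trans (⊙-cong (sign*sign≈1 s) refl) (⊙-one _)))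
      (scale (sign s) (generator p))

  ψ-reduce-φ-dendrMono : ∀ σ a b → ψ-reduce-φ (dendrMono σ a b) ≈ᴰ dendrMono σ a b
  ψ-reduce-φ-dendrMono σ a b with classify σ
  ... | isNormal k          = ≋⇒≈ᴰ (ψ-reduce-φ-normal k a b)
  ... | isLeading (inner s) = ψ-reduce-φ-expansion s (proj₂ (minimum a b))
  ... | isLeading (outer s) = ψ-reduce-φ-expansion s (proj₂ (minimum a b))
  ... | isLeading swap      = Q.≈ᴹ-trans
    (≋⇒≈ᴰ (trans
      (ψ.cong (reduce-cong {φ.⟦ dendrMono (leading swap) a b ⟧} {φ.⟦ dendrMono (normal swap) b a ⟧}
        λ k c d → pairing-φ-swap k c d a b))
      (ψ-reduce-φ-normal swap b a)))
    (Q.≈ᴹ-sym (generator (generator (rel₁ a b))))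

  dendr-surjective : ∀ (x : DendrGen γ) → ∃[ s ] ∃[ a ] dendr s a ≡ x
  dendr-surjective (≺ a) = ◂ , a , ≡.refl
  dendr-surjective (≻ a) = ▸ , a , ≡.refl

  dendrMono-basis : (t : TreeOfArity (DendrGen γ) 3) → ∃[ σ ] ∃[ a ] ∃[ b ] dendrMono σ a b ≡ [ t ]
  dendrMono-basis (t , e) with 3-leaves t (recompute (leaves t ℕ.≟ 3) e)
  ... | x , y , inj₁ ≡.refl with dendr-surjective x | dendr-surjective y
  ...   | s , a , ≡.refl | t , b , ≡.refl = ⟪ ◂ , s , t ⟫ , a , b , ≡.refl
  dendrMono-basis (t , e) | x , y , inj₂ ≡.refl with dendr-surjective x | dendr-surjective y
  ...   | s , a , ≡.refl | t , b , ≡.refl = ⟪ ▸ , s , t ⟫ , a , b , ≡.refl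

  ψ-reduce-φ≈id : ∀ x → ψ-reduce-φ x ≈ᴰ x
  ψ-reduce-φ≈id = linear-unique (Q.space 3) (∘-isLinear (Q.space 3) quotient-isLinear ψ-reduce-φ-isLinear)
    quotient-isLinear basis
    where
    quotient-isLinear : IsLinear (Q.space 3) (λ x → x)
    quotient-isLinear = record
      { cong    = ≋⇒≈ᴰ
      ; 0-homo  = Q.≈ᴹ-refl {3} {𝟘}
      ; +-homo  = λ x y → Q.≈ᴹ-refl {3} {x ⊕ y}
      ; *ₗ-homo = λ a x → Q.≈ᴹ-refl {3} {a ⊙ x}
      }
    basis : ∀ t → ψ-reduce-φ [ t ] ≈ᴰ [ t ]
    basis t with dendrMono-basis t
    ... | σ , a , b , ≡.refl = ψ-reduce-φ-dendrMono σ a b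

  Annihilator⊆DendrRelations : ∀ {f} → f ∈ Annihilator _≟ᴰ_ DiasRelations →
    ψ.⟦ f ⟧ ∈ Ideal (Free (DendrGen γ)) DendrRelations
  Annihilator⊆DendrRelations {f} ann = resp
    -- Being congruent to `𝟘` unfolds to membership of `ψ.⟦ f ⟧ ⊕ (- 1#) ⊙ 𝟘` in the ideal; the zero
    -- term is removed here.
    (trans (⊕-cong (refl {x = ψ.⟦ f ⟧}) (Module.*ₗ-zeroʳ (D.space 3) (- 1#)))
      (trans (⊕-comm ψ.⟦ f ⟧ 𝟘) (⊕-unit ψ.⟦ f ⟧)))
    ψf≈0
    where
    open SetoidReasoning (Q.≈ᴹ-setoid {3})
    ψf≈0 : ψ.⟦ f ⟧ ≈ᴰ 𝟘
    ψf≈0 = begin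
      ψ.⟦ f ⟧               ≈⟨ ψ-reduce-φ≈id ψ.⟦ f ⟧ ⟨
      ψ-reduce-φ ψ.⟦ f ⟧    ≈⟨ ≋⇒≈ᴰ (ψ.cong (IsLinear.cong reduce-isLinear
                                 {φ.⟦ ψ.⟦ f ⟧ ⟧} {f} (leftInverse ψ φ φψ-gen f))) ⟩
      ψ.⟦ reduce f ⟧        ≈⟨ ≋⇒≈ᴰ (ψ.cong (reduce-cong {f} {𝟘} λ k a b →
                                 K.trans (ann (relator k a b) (generator (relator∈ k a b)))
                                   (K.sym (IsLinear.0-homo (pairing-isLinear (relator k a b)))))) ⟩
      ψ.⟦ reduce 𝟘 ⟧        ≈⟨ ≋⇒≈ᴰ (ψ.cong (IsLinear.0-homo reduce-isLinear)) ⟩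
      ψ.⟦ 𝟘 ⟧               ≈⟨ ≋⇒≈ᴰ ψ.0-homo ⟩
      𝟘                     ∎

  presentation : Presentation Dendr DendrRelations
  presentation = quotient-isomorphism φ ψ ψφ-gen φψ-gen
    (λ {x} → DendrRelations⊆Annihilator {x}) (λ {f} → Annihilator⊆DendrRelations {f})

theorem4p1p4 : {c ℓ₁ ℓ₂ : Level} (K : HeytingField c ℓ₁ ℓ₂) → CharacteristicZero K →
  (γ : ℕ) →
  let open PolydendriformOperads (fieldRing K) γ
      open Operad Dendr using (_≈ᴹ_)
      open OperadIsomorphism using (⟦_⟧)
  in Σ[ φ ∈ Presentation Dendr DendrRelations ]
       ((b : Fin γ) → (⟦ φ ⟧ (gen (≺ b)) ≈ᴹ ∑↼ b) × (⟦ φ ⟧ (gen (≻ b)) ≈ᴹ ∑⇀ b))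
-- The isomorphism is `φ` on representatives; its values on generators hold in the free operad
-- already and descend by `≈⇒∼`.
theorem4p1p4 K _ γ = presentation , λ b →
    ≈⇒∼ (Free (DiasGen γ)) (Annihilator _≟ᴰ_ DiasRelations) (φ-gen (≺ b))
  , ≈⇒∼ (Free (DiasGen γ)) (Annihilator _≟ᴰ_ DiasRelations) (φ-gen (≻ b))
  where
  open PolydendriformOperads (fieldRing K) γ
  open Polydendriform (fieldRing K) γ
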